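{- Let $p$ be an odd prime, let $s\ge 0$ be an integer, let $\delta\in\{1,-1\}$, and let $r$ be an integer with $r\ge\max\{3,s+1\}$ and $p\nmid r$. Let $G$ be a group of automorphisms of the augmented PX graph $\mathrm{C}^*(p,r,s,\delta)$ acting regularly on its arcs. Then $G\cong\mathbb{Z}_p^{s+1}\rtimes\mathrm{D}_{2r}$.
   Context: Graphs may have multiple edges but no loops; an arc is a pair (vertex, incident edge) i.e. a directed edge. $\mathrm{D}_{2r}$ is the dihedral group of order $2r$. For $s\ge 1$, the Praeger–Xu graph $\mathrm{C}(p,r,s)$ is the simple graph with vertex set $\mathbb{Z}_r\times\mathbb{Z}_p^s$ in which $(i,x_0,\dots,x_{s-1})$ is adjacent to $(i+1,x_1,\dots,x_s)$ for all $i\in\mathbb{Z}_r$, $x_j\in\mathbb{Z}_p$. The augmented PX graph $\mathrm{C}^*(p,r,s,\delta)$ is: $\mathrm{C}(p,r,s)$ if $s\ge 1$; for $s=0,\delta=1$, the cycle of length $r$ in which each pair of adjacent vertices is joined by $p$ parallel edges; for $s=0,\delta=-1$, the simple cycle $\mathrm{C}_{pr}$ of length $pr$. -}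

module Defs where

open import Level using (Level; _⊔_)
open import Data.Nat using (ℕ; zero; suc; _+_; _*_; _∸_)
open import Data.Nat.DivMod using (_mod_)
open import Data.Fin using (Fin; toℕ)
open import Data.Vec using (Vec; init; tail; zipWith)
open import Data.Bool using (Bool; true; false; if_then_else_; _xor_)
open import Data.Sign using (Sign)
open import Data.Product using (Σ; _×_; _,_; proj₁; proj₂; ∃)
open import Data.Sum using (_⊎_)
open import Relation.Binary.PropositionalEquality using (_≡_)
open import Algebra.Bundles using (Group)

_+ₘ_ : ∀ {n} → Fin n → Fin n → Fin n
_+ₘ_ {suc n} i j = (toℕ i + toℕ j) mod (suc n)

-ₘ_ : ∀ {n} → Fin n → Fin n
-ₘ_ {suc n} i = (suc n ∸ toℕ i) mod (suc n)

sucₘ : ∀ {n} → Fin n → Fin n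
sucₘ {suc n} i = suc (toℕ i) mod (suc n)

record Multigraph : Set₁ where
  field
    V    : Set
    E    : Set
    end₁ : E → V
    end₂ : E → V

Arc : Multigraph → Set
Arc Γ = Σ V λ v → Σ E λ e → (v ≡ end₁ e ⊎ v ≡ end₂ e)
  where open Multigraph Γ

-- Praeger–Xu graph C(p,r,s), s ≥ 1 (given as s = suc t).
-- Vertex set ℤ_r × ℤ_p^s.  The edge {(i,x_0..x_{s-1}),(i+1,x_1..x_s)}
-- is indexed by (i, x_0..x_s) ∈ ℤ_r × ℤ_p^{s+1}.

PX : (p r s : ℕ) → Multigraph
PX p r s = record
  { V    = Fin r × Vec (Fin p) s
  ; E    = Fin r × Vec (Fin p) (suc s)
  ; end₁ = λ e → proj₁ e , init (proj₂ e)
  ; end₂ = λ e → sucₘ (proj₁ e) , tail (proj₂ e)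
  }

FatCycle : (p r : ℕ) → Multigraph
FatCycle p r = record
  { V = Fin r ; E = Fin r × Fin p
  ; end₁ = λ e → proj₁ e ; end₂ = λ e → sucₘ (proj₁ e) }

Cycle : (n : ℕ) → Multigraph
Cycle n = record { V = Fin n ; E = Fin n ; end₁ = λ e → e ; end₂ = sucₘ }

CStar : (p r s : ℕ) → Sign → Multigraph
CStar p r (suc t) δ        = PX p r (suc t)
CStar p r zero    Sign.+   = FatCycle p r
CStar p r zero    Sign.-   = Cycle (p * r)

-- A group G of automorphisms of Γ: a faithful action of G on Γ
-- by automorphisms (vertex map and edge map preserving incidence).

record AutAction {c ℓ} (G : Group c ℓ) (Γ : Multigraph) : Set (c ⊔ ℓ) where
  open Group G renaming (Carrier to X)
  open Multigraph Γ
  field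
    actV : X → V → V
    actE : X → E → E
    actV-cong : ∀ {g h} → g ≈ h → ∀ v → actV g v ≡ actV h v
    actE-cong : ∀ {g h} → g ≈ h → ∀ e → actE g e ≡ actE h e
    actV-ε : ∀ v → actV ε v ≡ v
    actE-ε : ∀ e → actE ε e ≡ e
    actV-∙ : ∀ g h v → actV (g ∙ h) v ≡ actV g (actV h v)
    actE-∙ : ∀ g h e → actE (g ∙ h) e ≡ actE g (actE h e)
    incidence : ∀ g e →
      (end₁ (actE g e) ≡ actV g (end₁ e) × end₂ (actE g e) ≡ actV g (end₂ e))
      ⊎ (end₁ (actE g e) ≡ actV g (end₂ e) × end₂ (actE g e) ≡ actV g (end₁ e))
    faithful : ∀ g → (∀ v → actV g v ≡ v) → (∀ e → actE g e ≡ e) → g ≈ ε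

  _maps_to_ : X → Arc Γ → Arc Γ → Set
  g maps a to b = actV g (proj₁ a) ≡ proj₁ b × actE g (proj₁ (proj₂ a)) ≡ proj₁ (proj₂ b)

  ArcRegular : Set (c ⊔ ℓ)
  ArcRegular = (∀ a b → ∃ λ g → g maps a to b)
             × (∀ g a → g maps a to a → g ≈ ε)

-- The dihedral group D_{2r} = ⟨ρ,σ⟩: (k , b) stands for ρ^k σ^b.

Dih : ℕ → Set
Dih r = Fin r × Bool

_·D_ : ∀ {r} → Dih r → Dih r → Dih r
(k₁ , b₁) ·D (k₂ , b₂) = (k₁ +ₘ (if b₁ then -ₘ k₂ else k₂)) , (b₁ xor b₂)

ZV : ℕ → ℕ → Set
ZV p m = Vec (Fin p) m

_+V_ : ∀ {p m} → ZV p m → ZV p m → ZV p m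
_+V_ = zipWith _+ₘ_

record DihAction (p m r : ℕ) : Set where
  field
    θ     : Dih r → ZV p m → ZV p m
    θ-add : ∀ d u w → θ d (u +V w) ≡ θ d u +V θ d w
    θ-hom : ∀ d₁ d₂ u → θ (d₁ ·D d₂) u ≡ θ d₁ (θ d₂ u)
    θ-id  : ∀ (z : Fin r) u → toℕ z ≡ 0 → θ (z , false) u ≡ u

SDmul : ∀ {p m r} → DihAction p m r → (ZV p m × Dih r) → (ZV p m × Dih r) → (ZV p m × Dih r)
SDmul A (u₁ , d₁) (u₂ , d₂) = (u₁ +V DihAction.θ A d₁ u₂) , (d₁ ·D d₂)

record IsoToSD {c ℓ} (G : Group c ℓ) {p m r} (A : DihAction p m r) : Set (c ⊔ ℓ) where
  open Group G renaming (Carrier to X)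
  field
    f       : X → ZV p m × Dih r
    f-cong  : ∀ {g h} → g ≈ h → f g ≡ f h
    f-inj   : ∀ g h → f g ≡ f h → g ≈ h
    f-surj  : ∀ y → ∃ λ g → f g ≡ y
    f-hom   : ∀ g h → f (g ∙ h) ≡ SDmul A (f g) (f h)

{-# OPTIONS --safe #-}
-- Once every automorphism in G is known to preserve or to reverse the direction i → i+1 of the edges, G maps onto D_2r
-- and the kernel K acts on the p values of each coordinate of an edge, simply transitively on the (s+1)-tuples.
-- K has order p^(s+1), so the stabilizer in K of one value of a coordinate, being a p-group on fewer than p further
-- values, fixes them all; hence K ≅ ℤ_p^(s+1).  The extension splits because p is odd and prime to r: involutions of
-- D_2r lift to involutions, the product of two of them is a rotation ρ₀ inverted by both, and a suitable power of ρ₀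
-- has order r.
--
-- Directions are preserved or reversed because, for s ≥ 2, two in-neighbours (or out-neighbours) of a vertex have
-- p ≥ 3 common neighbours, while an in- and an out-neighbour have at most 2; for s = 1 and r ≠ 4 the fibres are the
-- classes of vertices with equal neighbourhoods.  C(p,4,1) is K_{2p,2p}, where G need not preserve the fibres; there
-- the elements of order p in vertex stabilizers provide a G-invariant partition into four blocks of size p, which can
-- take the place of the fibres.  The cycle C_pr is treated as a cycle of length r with p parallel edges by reducing
-- edge labels modulo r.
module Submission where

open import Algebra.Bundles using (AbelianGroup; Group)
open import Data.Bool using (Bool; _xor_; false; if_then_else_; not; true)
open import Data.Bool.Properties as Boolₚ using (not-involutive; not-¬; ¬-not)
open import Data.Empty using (⊥; ⊥-elim)
open import Data.Fin using (Fin; combine; fromℕ; inject₁; inject≤; punchOut; remQuot; suc; toℕ; zero) renaming (_≤_ to _≤ᶠ_)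
open import Data.Fin.Induction using (<-weakInduction; >-weakInduction)
open import Data.Fin.Patterns using (0F; 1F; 2F; 3F)
open import Data.Fin.Properties as Finₚ using (combine-remQuot; inject≤-injective; pigeonhole; punchOut-injective; remQuot-combine; toℕ-combine; toℕ-fromℕ<; toℕ-injective; toℕ-inject₁; toℕ<n; ≤fromℕ)
open import Data.List as List using (List; []; _++_; _∷_; allFin; applyUpTo; cartesianProductWith; filter; length; map)
open import Data.List.Membership.Propositional using (_∈_; _∉_; find; lose)
open import Data.List.Membership.Propositional.Properties using (∈-++⁺ʳ; ∈-++⁺ˡ; ∈-++⁻; ∈-allFin; ∈-applyUpTo⁺; ∈-applyUpTo⁻; ∈-cartesianProductWith⁺; ∈-cartesianProductWith⁻; ∈-filter⁺; ∈-filter⁻; ∈-lookup; ∈-map⁺; ∈-map⁻; ∈-∃++)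
open import Data.List.Properties using (filter-all; length-++; length-applyUpTo; length-map; length-tabulate)
open import Data.List.Relation.Binary.Subset.Propositional using (_⊆_)
open import Data.List.Relation.Unary.All as All using (All; []; _∷_)
open import Data.List.Relation.Unary.AllPairs using ([]; _∷_)
open import Data.List.Relation.Unary.Any as Any using (here; there)
open import Data.List.Relation.Unary.Any.Properties using (lookup-index)
open import Data.List.Relation.Unary.Unique.Propositional using (Unique)
open import Data.List.Relation.Unary.Unique.Propositional.Properties using (++⁺; Unique[x∷xs]⇒x∉xs; allFin⁺; applyUpTo⁺₁; cartesianProductWith⁺; filter⁺; map⁺)
open import Data.Nat using (>-nonZero; >-nonZero⁻¹; NonZero; _%_; _*_; _+_; _/_; _<_; _^_; _∸_; _≤_; _⊔_; suc; s≤s; s≤s⁻¹; zero; z≤n; ℕ)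
open import Data.Nat.Coprimality as Coprimality using (Coprime; coprime-Bézout; coprime-divisor; prime⇒coprime)
open import Data.Nat.DivMod using (%-distribˡ-+; %-remove-+ˡ; _mod_; m%n%n≡m%n; m%n<n; m<n⇒m%n≡m; m∣n⇒o%n%m≡o%m; m≡m%n+[m/n]*n; n%n≡0)
open import Data.Nat.Divisibility using (*-cancelˡ-∣; _∣0; _∣?_; _∣_; divides; m%n≡0⇒n∣m; m∣m*n; n∣m*n; ∣-refl; ∣-trans; ∣1⇒≡1; ∣m∣n⇒∣m+n; ∣⇒≤)
open import Data.Nat.GCD using (module Bézout)
open import Data.Nat.Induction using (<-rec)
open import Data.Nat.Primality using (Prime; prime⇒irreducible; prime⇒nonZero; ¬prime[0]; ¬prime[1])
open import Data.Nat.Properties as ℕₚ using (+-suc; anyUpTo?; n<1+n; ≤-antisym; ≤-refl; ≤-trans)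
open import Data.Nat.Tactic.RingSolver using (solve-∀)
open import Data.Product using (_,_; _×_; proj₁; proj₂; Σ; ∃; ∃₂)
open import Data.Product.Properties as Productₚ using ()
open import Data.Sign using (Sign)
open import Data.Sum as Sum using ([_,_]′; _⊎_; inj₁; inj₂)
open import Data.Unit using (tt; ⊤)
open import Data.Vec using (Vec; []; _∷_; _∷ʳ_; head; init; lookup; replicate; tabulate; tail)
open import Data.Vec.Properties as Vecₚ using (init-∷ʳ; lookup-replicate; lookup-zipWith; lookup∘tabulate; ∷-injective; ∷ʳ-injectiveʳ; ≡-dec)
open import Data.Vec.Relation.Binary.Pointwise.Extensional using (Pointwise-≡⇒≡; ext)
open import Defs
open import Function using (_∘_)
open import Level using (Level)
open import Relation.Binary.Definitions using (DecidableEquality; tri<; tri>; tri≈)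
open import Relation.Binary.PropositionalEquality as ≡ using (_≡_; _≢_; cong; cong₂; refl; subst; sym; trans)
open import Relation.Nullary using (Dec; contradiction; no; yes; ¬?; ¬_)
open import Relation.Nullary.Decidable using (decidable-stable; from-no)
open import Relation.Unary using (Decidable)

-- Neither finiteness nor decidable equality of `G` is assumed, so nothing is counted inside `G`. An
-- element is identified by where it sends an arc, and its order is bounded by counting a list of
-- points on which it acts semiregularly. The kernel acts on each coordinate separately because it
-- preserves the relation "one edge follows another": stepping backwards discards the last
-- coordinate, stepping forwards the first, so in the end the image of a coordinate depends on that
-- coordinate alone. In K_{2p,2p}, elements of order p come from a count in place of Cauchy's
-- theorem. A vertex stabilizer is regular on the 2p opposite vertices, so squares in it have order
-- dividing p; if all squares were trivial, a four-group would act freely on 2p points, impossible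
-- for p odd. The resulting subgroup of order p has index 2 and is unique in the stabilizer, so
-- "having the same such subgroup" is a G-invariant equivalence on vertices. Its classes have size p
-- unless the subgroup fixes a whole side; then its orbits on the other side are the blocks.

private variable
  a c ℓ : Level
  A : Set a

-- Finite sets and group actions

inverse-mod : ∀ {m n} → Coprime m n → 0 < m → ∃₂ λ x y → x * m ≡ 1 + y * n
inverse-mod {m} {n} cop 0<m with coprime-Bézout cop
... | Bézout.+- x y eq = x , y , sym eq
inverse-mod {m} {zero} cop 0<m | Bézout.-+ x y eq =
  contradiction (trans eq (ℕₚ.*-zeroʳ y)) λ ()
-- Here -x is the inverse, and `x * n` is congruent to -x modulo `suc n`. The extra `suc n` keeps
-- the cofactor on the right a natural number.
inverse-mod {suc m} {suc n} cop 0<m | Bézout.-+ x y eq = x * n + suc n , n * y + m ,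
  trans (regroupˡ x n m) (trans (cong (λ k → n * k + (suc n * m + 1)) eq) (regroupʳ n y m))
  where
  regroupˡ : ∀ x n m → (x * n + suc n) * suc m ≡ n * (1 + x * suc m) + (suc n * m + 1)
  regroupˡ = solve-∀
  regroupʳ : ∀ n y m → n * (y * suc n) + (suc n * m + 1) ≡ 1 + (n * y + m) * suc n
  regroupʳ = solve-∀

least : ∀ {q} {P : ℕ → Set q} → Decidable P → ∀ n → P n →
        ∃ λ m → P m × (∀ k → k < m → ¬ P k)
least {P = P} P? = <-rec _ step
  where
  step : ∀ n → (∀ {k} → k < n → P k → ∃ λ m → P m × (∀ k → k < m → ¬ P k)) →
         P n → ∃ λ m → P m × (∀ k → k < m → ¬ P k)
  step n rec pn with anyUpTo? P? n
  ... | yes (k , k<n , pk) = rec k<n pk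
  ... | no none            = n , pn , λ k k<n pk → none (k , k<n , pk)

Unique⊆⇒length≤ : ∀ {xs ys : List A} → Unique xs → xs ⊆ ys → length xs ≤ length ys
Unique⊆⇒length≤ {xs = []} _ _ = z≤n
Unique⊆⇒length≤ {xs = x ∷ xs} uniq@(_ ∷ uxs) sub with ∈-∃++ (sub (here refl))
... | as , bs , refl = subst (suc (length xs) ≤_) eq (s≤s (Unique⊆⇒length≤ uxs sub′))
  where
  x∉xs : x ∉ xs
  x∉xs = Unique[x∷xs]⇒x∉xs uniq
  sub′ : xs ⊆ as ++ bs
  sub′ {z} z∈xs with ∈-++⁻ as (sub (there z∈xs))
  ... | inj₁ z∈as         = ∈-++⁺ˡ z∈as
  ... | inj₂ (here refl)  = contradiction z∈xs x∉xs
  ... | inj₂ (there z∈bs) = ∈-++⁺ʳ as z∈bs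
  eq : suc (length (as ++ bs)) ≡ length (as ++ x ∷ bs)
  eq rewrite length-++ as {bs} | length-++ as {x ∷ bs} = sym (+-suc _ _)

length-filter-¬ : ∀ {q} {P : A → Set q} (P? : Decidable P) xs →
                  length xs ≡ length (filter P? xs) + length (filter (¬? ∘ P?) xs)
length-filter-¬ P? [] = refl
length-filter-¬ P? (x ∷ xs) with P? x
... | yes _ = cong suc (length-filter-¬ P? xs)
... | no _  = trans (cong suc (length-filter-¬ P? xs)) (sym (+-suc _ _))

0<length : ∀ {z : A} {zs} → z ∈ zs → 0 < length zs
0<length (here _)  = s≤s z≤n
0<length (there _) = s≤s z≤n

module Finite {A : Set a} (_≟_ : DecidableEquality A) where

  open import Data.List.Membership.DecPropositional _≟_ public using (_∈?_)

  Unique⊆∧length≥⇒⊇ : ∀ {xs ys : List A} → Unique xs → xs ⊆ ys → length ys ≤ length xs → ys ⊆ xs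
  Unique⊆∧length≥⇒⊇ {xs} {ys} uxs sub le {y} y∈ys with y ∈? xs
  ... | yes y∈xs = y∈xs
  ... | no y∉xs  = contradiction (≤-trans (Unique⊆⇒length≤ uniq sub′) le) (ℕₚ.<-irrefl refl)
    where
    uniq : Unique (y ∷ xs)
    uniq = All.tabulate (λ { z∈xs refl → y∉xs z∈xs }) ∷ uxs
    sub′ : y ∷ xs ⊆ ys
    sub′ (here refl) = y∈ys
    sub′ (there z∈)  = sub z∈

  ∃-outside : ∀ {xs ys : List A} → Unique ys → length xs < length ys → ∃ λ y → y ∈ ys × y ∉ xs
  ∃-outside {xs} {ys} uys lt with All.all? (_∈? xs) ys
  ... | yes all = contradiction (Unique⊆⇒length≤ uys (All.lookup all)) (ℕₚ.<⇒≱ lt)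
  ... | no ¬all = go ys ¬all
    where
    go : ∀ zs → ¬ All (_∈ xs) zs → ∃ λ y → y ∈ zs × y ∉ xs
    go [] ¬all = contradiction [] ¬all
    go (z ∷ zs) ¬all with z ∈? xs
    ... | no z∉xs  = z , here refl , z∉xs
    ... | yes z∈xs = let y , y∈ , y∉ = go zs (λ all → ¬all (z∈xs ∷ all)) in y , there y∈ , y∉

  injective⇒surjective : ∀ {xs : List A} → Unique xs → (∀ x → x ∈ xs) →
                         ∀ {f : A → A} → (∀ {x y} → f x ≡ f y → x ≡ y) → ∀ y → ∃ λ x → f x ≡ y
  injective⇒surjective {xs} uniq complete {f} inj y
    with ∈-map⁻ f (Unique⊆∧length≥⇒⊇ (map⁺ inj uniq) (λ _ → complete _)
                     (ℕₚ.≤-reflexive (sym (length-map f xs))) (complete y))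
  ... | x , _ , eq = x , sym eq

  module _ (d : ℕ) (O : A → List A) (length-O : ∀ x → length (O x) ≡ d)
           (refl-O : ∀ x → x ∈ O x) (sym-O : ∀ {x y} → y ∈ O x → x ∈ O y)
           (trans-O : ∀ {x y z} → y ∈ O x → z ∈ O y → z ∈ O x) where

    -- Removing the class of the first point leaves a closed list, since classes are disjoint.
    -- Repetition-free classes are demanded only for points of `xs`: a stabilizer may act freely on
    -- the opposite part and still fix points elsewhere.
    class-size-divides : ∀ xs → Unique xs → (∀ {x} → x ∈ xs → Unique (O x)) →
                         (∀ {x} → x ∈ xs → O x ⊆ xs) → d ∣ length xs
    class-size-divides xs = go (length xs) xs ≤-refl
      where
      -- `n` is a bound on the length: the remaining list is a filter, hence no structural sublist.
      go : ∀ n xs → length xs ≤ n → Unique xs → (∀ {x} → x ∈ xs → Unique (O x)) →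
           (∀ {x} → x ∈ xs → O x ⊆ xs) → d ∣ length xs
      go n [] _ _ _ _ = d ∣0
      go (suc n) xs@(x ∷ xs′) le uniq uO closed =
        subst (d ∣_) (sym split) (∣m∣n⇒∣m+n (subst (d ∣_) (sym zs≡d) ∣-refl)
          (go n ys ys≤n (filter⁺ (¬? ∘ (_∈? O x)) uniq) (uO ∘ proj₁ ∘ ∈-filter⁻ (¬? ∘ (_∈? O x))) closed′))
        where
        zs = filter (_∈? O x) xs
        ys = filter (¬? ∘ (_∈? O x)) xs
        split : length xs ≡ length zs + length ys
        split = length-filter-¬ (_∈? O x) xs
        O⊆zs : O x ⊆ zs
        O⊆zs z∈ = ∈-filter⁺ (_∈? O x) (closed (here refl) z∈) z∈
        zs≡d : length zs ≡ d
        zs≡d = ≤-antisym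
          (subst (length zs ≤_) (length-O x)
            (Unique⊆⇒length≤ (filter⁺ (_∈? O x) uniq) (proj₂ ∘ ∈-filter⁻ (_∈? O x) {xs = xs})))
          (subst (_≤ length zs) (length-O x) (Unique⊆⇒length≤ (uO (here refl)) O⊆zs))
        x∈zs : x ∈ zs
        x∈zs = O⊆zs (refl-O x)
        ys≤n : length ys ≤ n
        ys≤n = s≤s⁻¹ (≤-trans (ℕₚ.+-monoˡ-≤ (length ys) (0<length x∈zs)) (subst (_≤ suc n) split le))
        closed′ : ∀ {y} → y ∈ ys → O y ⊆ ys
        closed′ y∈ {z} z∈Oy with ∈-filter⁻ (¬? ∘ (_∈? O x)) {xs = xs} y∈
        ... | y∈xs , y∉Ox = ∈-filter⁺ (¬? ∘ (_∈? O x)) (closed y∈xs z∈Oy)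
                              (λ z∈Ox → y∉Ox (trans-O z∈Ox (sym-O z∈Oy)))

module Powers (G : Group c ℓ) where
  open Group G renaming (Carrier to X; refl to ≈-refl; sym to ≈-sym; trans to ≈-trans)
  open import Algebra.Properties.Monoid.Mult monoid public
    renaming (_×_ to _⋆_; ×-homo-+ to ⋆-homo-+; ×-assocˡ to ⋆-assoc; ×-congʳ to ⋆-congʳ; ×-congˡ to ⋆-congˡ)
    using ()
  open import Algebra.Properties.Group G public using (∙-cancelˡ; ∙-cancelʳ; ⁻¹-anti-homo-∙; inverseˡ-unique; inverseʳ-unique; ε⁻¹≈ε)

  ⋆-ε : ∀ n → n ⋆ ε ≈ ε
  ⋆-ε zero    = ≈-refl
  ⋆-ε (suc n) = ≈-trans (identityˡ _) (⋆-ε n)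

  ⋆-comm : ∀ m n x → m ⋆ (n ⋆ x) ≈ n ⋆ (m ⋆ x)
  ⋆-comm m n x = ≈-trans (⋆-assoc x m n) (≈-trans (⋆-congˡ (ℕₚ.*-comm m n)) (≈-sym (⋆-assoc x n m)))

  ∣-⋆ : ∀ {m n x} → m ∣ n → m ⋆ x ≈ ε → n ⋆ x ≈ ε
  ∣-⋆ {m} {n} {x} (divides q refl) eq = ≈-trans (≈-sym (⋆-assoc x q m)) (≈-trans (⋆-congʳ q eq) (⋆-ε q))

record Action {c ℓ a} (G : Group c ℓ) (A : Set a) : Set (c Level.⊔ ℓ Level.⊔ a) where
  open Group G using (_≈_; _∙_; ε) renaming (Carrier to X)
  field
    act      : X → A → A
    act-cong : ∀ {g h} → g ≈ h → ∀ x → act g x ≡ act h x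
    act-ε    : ∀ x → act ε x ≡ x
    act-∙    : ∀ g h x → act (g ∙ h) x ≡ act g (act h x)

module ActionProperties {G : Group c ℓ} {A : Set a} (α : Action G A) where
  open Group G renaming (Carrier to X; refl to ≈-refl; sym to ≈-sym; trans to ≈-trans)
  open Powers G
  open Action α

  act-⁻¹ˡ : ∀ g x → act (g ⁻¹) (act g x) ≡ x
  act-⁻¹ˡ g x = trans (sym (act-∙ _ _ _)) (trans (act-cong (inverseˡ g) x) (act-ε x))

  act-⁻¹ʳ : ∀ g x → act g (act (g ⁻¹) x) ≡ x
  act-⁻¹ʳ g x = trans (sym (act-∙ _ _ _)) (trans (act-cong (inverseʳ g) x) (act-ε x))

  act-injective : ∀ g {x y} → act g x ≡ act g y → x ≡ y
  act-injective g {x} {y} eq = trans (sym (act-⁻¹ˡ g x)) (trans (cong (act (g ⁻¹)) eq) (act-⁻¹ˡ g y))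

  act-+ : ∀ m n g x → act ((m + n) ⋆ g) x ≡ act (m ⋆ g) (act (n ⋆ g) x)
  act-+ m n g x = trans (act-cong (⋆-homo-+ g m n) x) (act-∙ _ _ x)

  fix-⋆ : ∀ n g {x} → act g x ≡ x → act (n ⋆ g) x ≡ x
  fix-⋆ zero    g eq = act-ε _
  fix-⋆ (suc n) g eq = trans (act-∙ _ _ _) (trans (cong (act g) (fix-⋆ n g eq)) eq)

  fix-* : ∀ m n g {x} → act (n ⋆ g) x ≡ x → act ((m * n) ⋆ g) x ≡ x
  fix-* m n g {x} eq = trans (sym (act-cong (⋆-assoc g m n) x)) (fix-⋆ m (n ⋆ g) eq)

  -- The exponents whose power fixes `x` are closed under combination, so a Bézout identity brings
  -- them down to 1.
  fix-coprime : ∀ {m n} g {x} → Coprime m n → 0 < m →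
                act (m ⋆ g) x ≡ x → act (n ⋆ g) x ≡ x → act g x ≡ x
  fix-coprime {m} {n} g {x} cop 0<m mx nx with inverse-mod cop 0<m
  ... | u , v , eq = trans (sym lhs) (fix-* u m g mx)
    where
    lhs : act ((u * m) ⋆ g) x ≡ act g x
    lhs = trans (act-cong (⋆-congˡ eq) x) (trans (act-∙ _ _ x) (cong (act g) (fix-* v n g nx)))

  fix-∸ : ∀ g {x} {i j} → i ≤ j → act (i ⋆ g) x ≡ act (j ⋆ g) x → act ((j ∸ i) ⋆ g) x ≡ x
  fix-∸ g {x} {i} {j} i≤j eq = act-injective (i ⋆ g)
    (trans (sym (act-+ i (j ∸ i) g x)) (trans (act-cong (⋆-congˡ (ℕₚ.m+[n∸m]≡n i≤j)) x) (sym eq)))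

  -- The first `d` iterates, possibly with repetitions. It is closed under `g` once `d ⋆ g ≈ ε`, and
  -- repetition-free once no smaller positive power fixes `x`.
  orbit : X → ℕ → A → List A
  orbit g d x = applyUpTo (λ i → act (i ⋆ g) x) d

  orbit-length : ∀ g d x → length (orbit g d x) ≡ d
  orbit-length g d x = length-applyUpTo (λ i → act (i ⋆ g) x) d

  orbit-unique : ∀ g d {x} → (∀ i → 0 < i → i < d → act (i ⋆ g) x ≢ x) → Unique (orbit g d x)
  orbit-unique g d free = applyUpTo⁺₁ _ d λ {i} {j} i<j j<d eq →
    free (j ∸ i) (ℕₚ.m<n⇒0<n∸m i<j) (ℕₚ.≤-<-trans (ℕₚ.m∸n≤m j i) j<d) (fix-∸ g (ℕₚ.<⇒≤ i<j) eq)

  orbit-⊆ : ∀ g d {x xs} → (∀ {y} → y ∈ xs → act g y ∈ xs) → x ∈ xs → orbit g d x ⊆ xs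
  orbit-⊆ g d {x} {xs} closed x∈ y∈ with ∈-applyUpTo⁻ _ y∈
  ... | i , _ , refl = go i
    where
    go : ∀ i → act (i ⋆ g) x ∈ xs
    go zero    = subst (_∈ xs) (sym (act-ε x)) x∈
    go (suc i) = subst (_∈ xs) (sym (act-∙ _ _ x)) (closed (go i))

  module Cyclic (g : X) (d : ℕ) .{{_ : NonZero d}} (d⋆g≈ε : d ⋆ g ≈ ε) where

    ⋆∈orbit : ∀ n x → act (n ⋆ g) x ∈ orbit g d x
    ⋆∈orbit n x = subst (_∈ orbit g d x) eq (∈-applyUpTo⁺ _ (m%n<n n d))
      where
      eq : act ((n % d) ⋆ g) x ≡ act (n ⋆ g) x
      eq = sym (trans (act-cong (⋆-congˡ (m≡m%n+[m/n]*n n d)) x)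
             (trans (act-+ (n % d) _ g x) (cong (act ((n % d) ⋆ g))
               (fix-* (n / d) d g (trans (act-cong d⋆g≈ε x) (act-ε x))))))

    orbit-refl : ∀ x → x ∈ orbit g d x
    orbit-refl x = subst (_∈ orbit g d x) (act-ε x) (⋆∈orbit 0 x)

    orbit-trans : ∀ {x y z} → y ∈ orbit g d x → z ∈ orbit g d y → z ∈ orbit g d x
    orbit-trans {x} y∈ z∈ with ∈-applyUpTo⁻ _ y∈ | ∈-applyUpTo⁻ _ z∈
    ... | i , _ , refl | j , _ , refl = subst (_∈ orbit g d x) (act-+ j i g x) (⋆∈orbit (j + i) x)

    orbit-sym : ∀ {x y} → y ∈ orbit g d x → x ∈ orbit g d y
    orbit-sym {x} y∈ with ∈-applyUpTo⁻ _ y∈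
    ... | i , i<d , refl = subst (_∈ orbit g d (act (i ⋆ g) x)) eq (⋆∈orbit (d ∸ i) _)
      where
      eq : act ((d ∸ i) ⋆ g) (act (i ⋆ g) x) ≡ x
      eq = trans (sym (act-+ (d ∸ i) i g x))
        (trans (act-cong (⋆-congˡ (ℕₚ.m∸n+n≡m (ℕₚ.<⇒≤ i<d))) x) (trans (act-cong d⋆g≈ε x) (act-ε x)))

    order-divides : DecidableEquality A → ∀ xs → Unique xs →
                    (∀ {x} → x ∈ xs → ∀ i → 0 < i → i < d → act (i ⋆ g) x ≢ x) →
                    (∀ {x} → x ∈ xs → act g x ∈ xs) → d ∣ length xs
    order-divides _≟_ xs uniq free closed =
      Finite.class-size-divides _≟_ d (orbit g d) (orbit-length g d)
        orbit-refl orbit-sym orbit-trans xs uniq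
        (λ x∈ → orbit-unique g d (free x∈)) (λ x∈ → orbit-⊆ g d closed x∈)

  -- Lagrange's theorem for one element. The pigeonhole principle gives a least period of `x₀`;
  -- freeness turns it into an exponent of `g`, and a shorter return at any other point of `xs`
  -- would be one at `x₀` too. So all orbits on `xs` have that length, which therefore divides
  -- `length xs`.
  pow-length : DecidableEquality A → ∀ g xs → Unique xs → ∀ {x₀} → x₀ ∈ xs →
               (∀ {x} → x ∈ xs → act g x ∈ xs) →
               (∀ {x} → x ∈ xs → ∀ n → act (n ⋆ g) x ≡ x → n ⋆ g ≈ ε) →
               length xs ⋆ g ≈ ε
  pow-length _≟_ g xs uniq {x₀} x₀∈ closed free = main (least (λ n → act (suc n ⋆ g) x₀ ≟ x₀) (proj₁ period) (proj₂ period))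
    where
    x∈ : ∀ n → act (n ⋆ g) x₀ ∈ xs
    x∈ n = orbit-⊆ g (suc n) closed x₀∈ (∈-applyUpTo⁺ (λ i → act (i ⋆ g) x₀) (n<1+n n))
    period : ∃ λ n → act (suc n ⋆ g) x₀ ≡ x₀
    period with pigeonhole (n<1+n (length xs)) (λ i → Any.index (x∈ (toℕ i)))
    ... | i , j , i<j , eq = toℕ j ∸ suc (toℕ i) ,
          subst (λ m → act (m ⋆ g) x₀ ≡ x₀) (ℕₚ.+-∸-assoc 1 i<j)
            (fix-∸ g (ℕₚ.<⇒≤ i<j) (trans (lookup-index (x∈ (toℕ i)))
              (trans (cong (List.lookup xs) eq) (sym (lookup-index (x∈ (toℕ j)))))))
    main : (∃ λ m → act (suc m ⋆ g) x₀ ≡ x₀ × (∀ k → k < m → act (suc k ⋆ g) x₀ ≢ x₀)) → length xs ⋆ g ≈ ε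
    main (m , fixed , smaller) = ∣-⋆ (Cyclic.order-divides g (suc m) d⋆g≈ε _≟_ xs uniq free′ closed) d⋆g≈ε
      where
      d⋆g≈ε : suc m ⋆ g ≈ ε
      d⋆g≈ε = free x₀∈ (suc m) fixed
      free′ : ∀ {x} → x ∈ xs → ∀ i → 0 < i → i < suc m → act (i ⋆ g) x ≢ x
      free′ x∈ (suc i) _ i<d eq = smaller i (s≤s⁻¹ i<d)
        (trans (act-cong (free x∈ (suc i) eq) x₀) (act-ε x₀))

-- Elementary abelian groups

lookup-ext : ∀ {A : Set a} {n} {u w : Vec A n} → (∀ j → lookup u j ≡ lookup w j) → u ≡ w
lookup-ext = Pointwise-≡⇒≡ ∘ ext

allVec : ∀ p n → List (Vec (Fin p) n)
allVec p zero    = [] ∷ []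
allVec p (suc n) = cartesianProductWith _∷_ (allFin p) (allVec p n)

∈-allVec : ∀ {p n} (v : Vec (Fin p) n) → v ∈ allVec p n
∈-allVec []      = here refl
∈-allVec (x ∷ v) = ∈-cartesianProductWith⁺ _∷_ (∈-allFin x) (∈-allVec v)

allVec-unique : ∀ p n → Unique (allVec p n)
allVec-unique p zero    = [] ∷ []
allVec-unique p (suc n) = cartesianProductWith⁺ _∷_ ∷-injective (allFin⁺ p) (allVec-unique p n)

length-cartesianProductWith : ∀ {A B C : Set a} (f : A → B → C) xs ys →
                              length (cartesianProductWith f xs ys) ≡ length xs * length ys
length-cartesianProductWith f [] ys = refl
length-cartesianProductWith f (x ∷ xs) ys =
  trans (length-++ (List.map (f x) ys)) (cong₂ _+_ (length-map (f x) ys) (length-cartesianProductWith f xs ys))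

length-allVec : ∀ p n → length (allVec p n) ≡ p ^ n
length-allVec p zero    = refl
length-allVec p (suc n) = trans (length-cartesianProductWith _∷_ (allFin p) (allVec p n))
  (cong₂ _*_ (length-tabulate {n = p} (λ i → i)) (length-allVec p n))

coprime-^ : ∀ {m p} n → Coprime m p → Coprime m (p ^ n)
coprime-^ zero    cop (_ , d∣1)     = ∣1⇒≡1 d∣1
coprime-^ (suc n) cop (d∣m , d∣p*pⁿ) = coprime-^ n cop
  (d∣m , coprime-divisor (λ (e∣d , e∣p) → cop (∣-trans e∣d d∣m , e∣p)) d∣p*pⁿ)

<prime⇒coprime : ∀ {p d} → Prime p → 0 < d → d < p → Coprime d p
<prime⇒coprime p-prime 0<d d<p = Coprimality.sym (prime⇒coprime p-prime {{>-nonZero 0<d}} d<p)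

toℕ-mod : ∀ k n .{{_ : NonZero n}} → toℕ (k mod n) ≡ k % n
toℕ-mod k n = toℕ-fromℕ< (m%n<n k n)

module PrimeDegree {G : Group c ℓ} {q : ℕ} (p-prime : Prime (suc (suc q)))
                   (α : Action G (Fin (suc (suc q)))) where
  open Group G using (_≈_; _∙_; ε; _⁻¹) renaming (Carrier to X)
  open Powers G
  open Action α
  open ActionProperties α

  private
    p : ℕ
    p = suc (suc q)

  private
    avoid : ∀ {g a b} → a ≢ b → act g a ≡ a → ∀ i → a ≢ act (i ⋆ g) b
    avoid {g} a≢b ga≡a i eq = a≢b (act-injective (i ⋆ g) (trans (fix-⋆ i g ga≡a) eq))

  -- The g-orbit of b avoids a, so it is shorter than p, hence coprime to the order of g.
  fixes-one⇒fixes-all : ∀ n g → (p ^ n) ⋆ g ≈ ε → ∀ {a} → act g a ≡ a → ∀ b → act g b ≡ b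
  fixes-one⇒fixes-all n g pow {a} ga≡a b with a Finₚ.≟ b
  ... | yes refl = ga≡a
  ... | no a≢b with pigeonhole (n<1+n (suc q)) (λ i → punchOut (avoid a≢b ga≡a (toℕ i)))
  ... | i , j , i<j , eq = fix-coprime g
          (coprime-^ n (<prime⇒coprime p-prime 0<d d<p)) 0<d
          (fix-∸ g (ℕₚ.<⇒≤ i<j) (punchOut-injective (avoid a≢b ga≡a (toℕ i)) (avoid a≢b ga≡a (toℕ j)) eq))
          (trans (act-cong pow b) (act-ε b))
    where
    0<d : 0 < toℕ j ∸ toℕ i
    0<d = ℕₚ.m<n⇒0<n∸m i<j
    d<p : toℕ j ∸ toℕ i < p
    d<p = ℕₚ.≤-<-trans (ℕₚ.m∸n≤m (toℕ j) (toℕ i)) (toℕ<n j)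

  -- Among p + 1 iterates of `a` two coincide, so some d with 0 < d ≤ p returns `a`. If d < p, then
  -- d is coprime to the order of `g`, and `g` itself fixes `a`.
  p⋆-fixes : ∀ n g → (p ^ n) ⋆ g ≈ ε → ∀ a → act (p ⋆ g) a ≡ a
  p⋆-fixes n g pow a with pigeonhole (n<1+n p) (λ i → act (toℕ i ⋆ g) a)
  ... | i , j , i<j , eq with (toℕ j ∸ toℕ i) ℕₚ.≟ p
  ...   | yes d≡p = subst (λ d → act (d ⋆ g) a ≡ a) d≡p (fix-∸ g (ℕₚ.<⇒≤ i<j) eq)
  ...   | no d≢p  = fix-⋆ p g (fix-coprime g
            (coprime-^ n (<prime⇒coprime p-prime (ℕₚ.m<n⇒0<n∸m i<j) (ℕₚ.≤∧≢⇒< d≤p d≢p)))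
            (ℕₚ.m<n⇒0<n∸m i<j) (fix-∸ g (ℕₚ.<⇒≤ i<j) eq) (trans (act-cong pow a) (act-ε a)))
    where
    d≤p : toℕ j ∸ toℕ i ≤ p
    d≤p = ℕₚ.≤-trans (ℕₚ.m∸n≤m (toℕ j) (toℕ i)) (s≤s⁻¹ (toℕ<n j))

module ElementaryAbelian (K : Group c ℓ) {q n : ℕ} (p-prime : Prime (suc (suc q)))
  (α : Fin n → Action K (Fin (suc (suc q))))
  (transitive : ∀ (t : Vec (Fin (suc (suc q))) n) →
                ∃ λ k → ∀ j → Action.act (α j) k zero ≡ lookup t j)
  (free : ∀ k → (∀ j → Action.act (α j) k zero ≡ zero) → Group._≈_ K k (Group.ε K))
  where
  open Group K renaming (Carrier to X; refl to ≈-refl; sym to ≈-sym; trans to ≈-trans)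
  open Powers K

  private
    p : ℕ
    p = suc (suc q)
    module A (j : Fin n) = Action (α j)
    module AP (j : Fin n) = ActionProperties (α j)
    module PD (j : Fin n) = PrimeDegree p-prime (α j)

  ≈-ext : ∀ {g h} → (∀ j → A.act j g zero ≡ A.act j h zero) → g ≈ h
  ≈-ext {g} {h} eq = ∙-cancelˡ (h ⁻¹) g h (≈-trans (free _ λ j →
    trans (A.act-∙ j _ _ _) (trans (cong (A.act j (h ⁻¹)) (eq j)) (AP.act-⁻¹ˡ j h zero)))
    (≈-sym (inverseˡ h)))

  private
    product : Action K (Vec (Fin p) n)
    product = record
      { act      = λ k v → tabulate (λ j → A.act j k (lookup v j))
      ; act-cong = λ g≈h v → Vecₚ.tabulate-cong (λ j → A.act-cong j g≈h _)
      ; act-ε    = λ v → lookup-ext (λ j → trans (lookup∘tabulate _ j) (A.act-ε j _))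
      ; act-∙    = λ g h v → Vecₚ.tabulate-cong (λ j → trans (A.act-∙ j g h _)
                     (cong (A.act j g) (sym (lookup∘tabulate _ j))))
      }

    -- Freeness is assumed only at the zero tuple; writing `v` as the image of zero under some `h`
    -- reduces to it, because `k ∙ h` and `h` then agree there.
    product-free : ∀ k v → Action.act product k v ≡ v → k ≈ ε
    product-free k v eq = ∙-cancelʳ h k ε (≈-trans (≈-ext same) (≈-sym (identityˡ h)))
      where
      h = proj₁ (transitive v)
      same : ∀ j → A.act j (k ∙ h) zero ≡ A.act j h zero
      same j rewrite A.act-∙ j k h zero | proj₂ (transitive v) j =
        trans (sym (lookup∘tabulate _ j)) (cong (λ w → lookup w j) eq)

    pⁿ⋆≈ε : ∀ k → (p ^ n) ⋆ k ≈ ε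
    pⁿ⋆≈ε k = ≈-trans (⋆-congˡ (sym (length-allVec p n)))
      (ActionProperties.pow-length product (≡-dec Finₚ._≟_) k (allVec p n) (allVec-unique p n)
        (∈-allVec (replicate n zero)) (λ _ → ∈-allVec _) (λ _ m → product-free (m ⋆ k) _))

  exponent : ∀ k → p ⋆ k ≈ ε
  exponent k = free _ λ j → PD.p⋆-fixes j n k (pⁿ⋆≈ε k) zero

  private
    -- `h ⁻¹ ∙ g` fixes zero in coordinate `j` and has p-power order, so it fixes all p values.
    -- Hence one value determines the whole action on a coordinate.
    agree : ∀ j g h → A.act j g zero ≡ A.act j h zero → ∀ b → A.act j g b ≡ A.act j h b
    agree j g h eq b = trans (sym (AP.act-⁻¹ʳ j h _)) (cong (A.act j h)
      (trans (sym (A.act-∙ j _ _ _)) (PD.fixes-one⇒fixes-all j n (h ⁻¹ ∙ g) (pⁿ⋆≈ε _)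
        (trans (A.act-∙ j _ _ _) (trans (cong (A.act j (h ⁻¹)) eq) (AP.act-⁻¹ˡ j h zero))) b)))

    -- This element moves zero to one in every coordinate at once, so its powers identify all the
    -- coordinates with the integers modulo p simultaneously.
    e : X
    e = proj₁ (transitive (replicate n (suc zero)))

    coord : Fin n → Fin p → Fin p
    coord j m = A.act j (toℕ m ⋆ e) zero

    coord-injective< : ∀ j {l m : Fin p} → toℕ l < toℕ m → coord j l ≢ coord j m
    coord-injective< j {l} {m} l<m eq = contradiction (trans (sym moved) fixed) λ ()
      where
      moved : A.act j e zero ≡ suc zero
      moved = trans (proj₂ (transitive _) j) (lookup-replicate j _)
      0<d : 0 < toℕ m ∸ toℕ l
      0<d = ℕₚ.m<n⇒0<n∸m l<m
      fixed : A.act j e zero ≡ zero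
      fixed = AP.fix-coprime j e
        (<prime⇒coprime p-prime 0<d (ℕₚ.≤-<-trans (ℕₚ.m∸n≤m (toℕ m) (toℕ l)) (toℕ<n m))) 0<d
        (AP.fix-∸ j e (ℕₚ.<⇒≤ l<m) eq) (trans (A.act-cong j (exponent e) zero) (A.act-ε j zero))

    coord-injective : ∀ j {l m} → coord j l ≡ coord j m → l ≡ m
    coord-injective j {l} {m} eq with ℕₚ.<-cmp (toℕ l) (toℕ m)
    ... | tri< l<m _ _ = contradiction eq (coord-injective< j l<m)
    ... | tri≈ _ l≡m _ = toℕ-injective l≡m
    ... | tri> _ _ m<l = contradiction (sym eq) (coord-injective< j m<l)

    coord-surjective : ∀ j y → ∃ λ m → coord j m ≡ y
    coord-surjective j = Finite.injective⇒surjective Finₚ._≟_ (allFin⁺ p) ∈-allFin (coord-injective j)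

    coord-+ : ∀ j l m → coord j (l +ₘ m) ≡ A.act j (toℕ l ⋆ e) (coord j m)
    coord-+ j l m = trans (A.act-cong j reduce zero) (AP.act-+ j (toℕ l) (toℕ m) e zero)
      where
      t = toℕ l + toℕ m
      reduce : toℕ (l +ₘ m) ⋆ e ≈ t ⋆ e
      reduce = ≈-sym (≈-trans (⋆-congˡ (m≡m%n+[m/n]*n t p)) (≈-trans (⋆-homo-+ e (t % p) (t / p * p))
        (≈-trans (∙-congˡ (≈-trans (≈-sym (⋆-assoc e (t / p) p)) (≈-trans (⋆-congʳ (t / p) (exponent e)) (⋆-ε (t / p)))))
          (≈-trans (identityʳ _) (⋆-congˡ (sym (toℕ-mod t p)))))))

  -- Each entry of `u` is the exponent of `e` to be imitated in its coordinate. The exponents differ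
  -- between coordinates, so the element comes from transitivity and need not be a power of `e`.
  Φ : Vec (Fin p) n → X
  Φ u = proj₁ (transitive (tabulate (λ j → coord j (lookup u j))))

  private
    Φ-coord : ∀ u j → A.act j (Φ u) zero ≡ coord j (lookup u j)
    Φ-coord u j = trans (proj₂ (transitive _) j) (lookup∘tabulate _ j)

  Φ-homo : ∀ u w → Φ (u +V w) ≈ Φ u ∙ Φ w
  Φ-homo u w = ≈-ext λ j → trans (Φ-coord (u +V w) j)
    (trans (cong (coord j) (lookup-zipWith _+ₘ_ j u w))
    (trans (coord-+ j (lookup u j) (lookup w j))
    (trans (sym (agree j (Φ u) _ (Φ-coord u j) _))
    (trans (cong (A.act j (Φ u)) (sym (Φ-coord w j))) (sym (A.act-∙ j (Φ u) (Φ w) zero))))))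

  Φ-injective : ∀ {u w} → Φ u ≈ Φ w → u ≡ w
  Φ-injective {u} {w} eq = lookup-ext λ j → coord-injective j
    (trans (sym (Φ-coord u j)) (trans (A.act-cong j eq zero) (Φ-coord w j)))

  Φ-surjective : ∀ k → ∃ λ u → Φ u ≈ k
  Φ-surjective k = u , ≈-ext λ j → trans (Φ-coord u j)
    (trans (cong (coord j) (lookup∘tabulate _ j)) (proj₂ (coord-surjective j _)))
    where
    u : Vec (Fin p) n
    u = tabulate (λ j → proj₁ (coord-surjective j (A.act j k zero)))

-- Arithmetic modulo n, dihedral quotients and semidirect products

module Modular (m : ℕ) where

  [_] : ℕ → Fin (suc m)
  [ k ] = k mod suc m

  []-cong : ∀ j k → j % suc m ≡ k % suc m → [ j ] ≡ [ k ]
  []-cong j k eq = toℕ-injective (trans (toℕ-mod j _) (trans eq (sym (toℕ-mod k _))))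

  [toℕ] : ∀ i → [ toℕ i ] ≡ i
  [toℕ] i = toℕ-injective (trans (toℕ-mod (toℕ i) _) (m<n⇒m%n≡m (toℕ<n i)))

  []-+ : ∀ j k → [ j ] +ₘ [ k ] ≡ [ j + k ]
  []-+ j k = []-cong (toℕ [ j ] + toℕ [ k ]) (j + k) (trans (cong₂ (λ a b → (a + b) % suc m) (toℕ-mod j _) (toℕ-mod k _))
                       (sym (%-distribˡ-+ j k (suc m))))

  [n]≡zero : [ suc m ] ≡ zero
  [n]≡zero = toℕ-injective (trans (toℕ-mod (suc m) _) (n%n≡0 (suc m)))

  sucₘ-[] : ∀ k → sucₘ [ k ] ≡ [ suc k ]
  sucₘ-[] k = []-cong (suc (toℕ [ k ])) (suc k) (trans (cong (λ a → suc a % suc m) (toℕ-mod k _)) lem)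
    where
    lem : suc (k % suc m) % suc m ≡ suc k % suc m
    lem = trans (%-distribˡ-+ 1 (k % suc m) (suc m))
      (trans (cong (λ a → (1 % suc m + a) % suc m) (m%n%n≡m%n k (suc m))) (sym (%-distribˡ-+ 1 k (suc m))))

  +ₘ-comm : ∀ (i j : Fin (suc m)) → i +ₘ j ≡ j +ₘ i
  +ₘ-comm i j = cong (_mod suc m) (ℕₚ.+-comm (toℕ i) (toℕ j))

  +ₘ-assoc : ∀ (i j k : Fin (suc m)) → (i +ₘ j) +ₘ k ≡ i +ₘ (j +ₘ k)
  +ₘ-assoc i j k = trans (cong ([ toℕ i + toℕ j ] +ₘ_) (sym ([toℕ] k)))
    (trans ([]-+ (toℕ i + toℕ j) (toℕ k)) (trans (cong [_] (ℕₚ.+-assoc (toℕ i) (toℕ j) (toℕ k)))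
    (trans (sym ([]-+ (toℕ i) (toℕ j + toℕ k))) (cong (_+ₘ [ toℕ j + toℕ k ]) ([toℕ] i)))))

  +ₘ-identityˡ : ∀ (i : Fin (suc m)) → zero +ₘ i ≡ i
  +ₘ-identityˡ = [toℕ]

  +ₘ-identityʳ : ∀ (i : Fin (suc m)) → i +ₘ zero ≡ i
  +ₘ-identityʳ i = trans (+ₘ-comm i zero) (+ₘ-identityˡ i)

  +ₘ-inverseʳ : ∀ (i : Fin (suc m)) → i +ₘ (-ₘ i) ≡ zero
  +ₘ-inverseʳ i = trans (cong (_+ₘ (-ₘ i)) (sym ([toℕ] i))) (trans ([]-+ (toℕ i) (suc m ∸ toℕ i))
    (trans (cong [_] (ℕₚ.m+[n∸m]≡n (ℕₚ.<⇒≤ (toℕ<n i)))) [n]≡zero))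

  +ₘ-inverseˡ : ∀ (i : Fin (suc m)) → (-ₘ i) +ₘ i ≡ zero
  +ₘ-inverseˡ i = trans (+ₘ-comm (-ₘ i) i) (+ₘ-inverseʳ i)

  +ₘ-abelianGroup : AbelianGroup _ _
  +ₘ-abelianGroup = record
    { Carrier = Fin (suc m) ; _≈_ = _≡_ ; _∙_ = _+ₘ_ ; ε = zero ; _⁻¹ = -ₘ_
    ; isAbelianGroup = record
      { isGroup = record
        { isMonoid = record
          { isSemigroup = record
            { isMagma = record { isEquivalence = ≡.isEquivalence ; ∙-cong = cong₂ _+ₘ_ }
            ; assoc = +ₘ-assoc }
          ; identity = +ₘ-identityˡ , +ₘ-identityʳ }
        ; inverse = +ₘ-inverseˡ , +ₘ-inverseʳ
        ; ⁻¹-cong = cong -ₘ_ }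
      ; comm = +ₘ-comm } }

  open import Algebra.Properties.AbelianGroup +ₘ-abelianGroup public
    using () renaming (⁻¹-∙-comm to -ₘ-+ₘ-comm; ⁻¹-involutive to -ₘ-involutive; ε⁻¹≈ε to -ₘ-zero;
                       ∙-cancelˡ to +ₘ-cancelˡ; ∙-cancelʳ to +ₘ-cancelʳ)

  sucₘ-+ : ∀ (i : Fin (suc m)) → sucₘ i ≡ [ 1 ] +ₘ i
  sucₘ-+ i = trans (cong sucₘ (sym ([toℕ] i))) (trans (sucₘ-[] (toℕ i))
    (trans (sym ([]-+ 1 (toℕ i))) (cong ([ 1 ] +ₘ_) ([toℕ] i))))

  sucₘ-injective : ∀ {i j : Fin (suc m)} → sucₘ i ≡ sucₘ j → i ≡ j
  sucₘ-injective {i} {j} eq = +ₘ-cancelˡ [ 1 ] i j (trans (sym (sucₘ-+ i)) (trans eq (sucₘ-+ j)))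

  predₘ : ∀ (i : Fin (suc m)) → ∃ λ j → sucₘ j ≡ i
  predₘ i = (-ₘ [ 1 ]) +ₘ i , trans (sucₘ-+ _) (trans (sym (+ₘ-assoc [ 1 ] (-ₘ [ 1 ]) i))
    (trans (cong (_+ₘ i) (+ₘ-inverseʳ [ 1 ])) (+ₘ-identityˡ i)))

  sucₘ^ : ℕ → Fin (suc m) → Fin (suc m)
  sucₘ^ zero    i = i
  sucₘ^ (suc k) i = sucₘ (sucₘ^ k i)

  sucₘ^-+ : ∀ k i → sucₘ^ k i ≡ [ k ] +ₘ i
  sucₘ^-+ zero    i = sym (+ₘ-identityˡ i)
  sucₘ^-+ (suc k) i = trans (cong sucₘ (sucₘ^-+ k i)) (trans (sucₘ-+ _)
    (trans (sym (+ₘ-assoc [ 1 ] [ k ] i)) (cong (_+ₘ i) ([]-+ 1 k))))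

  sucₘ^-fixed : ∀ k {i} → sucₘ^ k i ≡ i → suc m ∣ k
  sucₘ^-fixed k {i} eq = m%n≡0⇒n∣m k (suc m) (trans (sym (toℕ-mod k (suc m)))
    (cong toℕ (+ₘ-cancelʳ i [ k ] zero (trans (sym (sucₘ^-+ k i)) (trans eq (sym (+ₘ-identityˡ i)))))))

  sucₘ^-reaches : ∀ i j → ∃ λ k → sucₘ^ k i ≡ j
  sucₘ^-reaches i j = toℕ k , trans (sucₘ^-+ (toℕ k) i) (trans (cong (_+ₘ i) ([toℕ] k))
    (trans (+ₘ-assoc j (-ₘ i) i) (trans (cong (j +ₘ_) (+ₘ-inverseˡ i)) (+ₘ-identityʳ j))))
    where
    k = j +ₘ (-ₘ i)

  sucₘ-+ʳ : ∀ k i → sucₘ (k +ₘ i) ≡ k +ₘ sucₘ i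
  sucₘ-+ʳ k i = trans (sucₘ-+ _) (trans (sym (+ₘ-assoc [ 1 ] k i)) (trans (cong (_+ₘ i) (+ₘ-comm [ 1 ] k))
    (trans (+ₘ-assoc k [ 1 ] i) (cong (k +ₘ_) (sym (sucₘ-+ i))))))

  sucₘ-neg : ∀ k i → sucₘ (k +ₘ (-ₘ sucₘ i)) ≡ k +ₘ (-ₘ i)
  sucₘ-neg k i = trans (sucₘ-+ʳ k (-ₘ sucₘ i)) (cong (k +ₘ_) (trans (sucₘ-+ _)
    (trans (cong (λ j → [ 1 ] +ₘ (-ₘ j)) (sucₘ-+ i)) (trans (cong ([ 1 ] +ₘ_) (sym (-ₘ-+ₘ-comm [ 1 ] i)))
    (trans (sym (+ₘ-assoc [ 1 ] (-ₘ [ 1 ]) (-ₘ i))) (trans (cong (_+ₘ (-ₘ i)) (+ₘ-inverseʳ [ 1 ])) (+ₘ-identityˡ (-ₘ i))))))))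

  sucₘ≢ : 3 ≤ suc m → ∀ {i : Fin (suc m)} → sucₘ i ≢ i
  sucₘ≢ 3≤r eq = ℕₚ.<⇒≱ 3≤r (ℕₚ.≤-trans (∣⇒≤ (sucₘ^-fixed 1 eq)) (s≤s z≤n))

  sucₘsucₘ≢ : 3 ≤ suc m → ∀ {i : Fin (suc m)} → sucₘ (sucₘ i) ≢ i
  sucₘsucₘ≢ 3≤r eq = ℕₚ.<⇒≱ 3≤r (∣⇒≤ (sucₘ^-fixed 2 eq))

prime-∤⇒coprime : ∀ {p n} → Prime p → ¬ (p ∣ n) → Coprime p n
prime-∤⇒coprime p-prime p∤n {d} (d∣p , d∣n) with prime⇒irreducible p-prime d∣p
... | inj₁ d≡1  = d≡1
... | inj₂ refl = contradiction d∣n p∤n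

odd : ∀ n → ¬ (2 ∣ n) → ∃ λ h → n ≡ 1 + h * 2
odd n 2∤n with n % 2 in eq | m%n<n n 2
... | 0 | _ = contradiction (m%n≡0⇒n∣m n 2 eq) 2∤n
... | 1 | _ = n / 2 , trans (m≡m%n+[m/n]*n n 2) (cong (_+ n / 2 * 2) eq)
... | suc (suc _) | s≤s (s≤s ())

1D : ∀ {m} → Dih (suc m)
1D = zero , false

record DihedralQuotient {c ℓ} (G : Group c ℓ) (m : ℕ) : Set (c Level.⊔ ℓ) where
  open Group G using (_≈_; _∙_) renaming (Carrier to X)
  field
    π            : X → Dih (suc m)
    π-cong       : ∀ {g h} → g ≈ h → π g ≡ π h
    π-homo       : ∀ g h → π (g ∙ h) ≡ π g ·D π h
    π-surjective : ∀ d → ∃ λ g → π g ≡ d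

module QuotientProperties {G : Group c ℓ} {m : ℕ} (Q : DihedralQuotient G m) where
  open Group G renaming (Carrier to X; refl to ≈-refl; sym to ≈-sym; trans to ≈-trans)
  open Powers G
  open DihedralQuotient Q
  open Modular m

  D-identityˡ : ∀ (d : Dih (suc m)) → 1D ·D d ≡ d
  D-identityˡ (k , b) = cong (_, b) (+ₘ-identityˡ k)

  D-identityʳ : ∀ (d : Dih (suc m)) → d ·D 1D ≡ d
  D-identityʳ (k , false) = cong (_, false) (+ₘ-identityʳ k)
  D-identityʳ (k , true)  = cong (_, true) (trans (cong (k +ₘ_) -ₘ-zero) (+ₘ-identityʳ k))

  D-cancelˡ : ∀ (d d′ : Dih (suc m)) → d ·D d′ ≡ d → d′ ≡ 1D
  D-cancelˡ (k , false) (k′ , false) eq =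
    cong (_, false) (+ₘ-cancelˡ k k′ zero (trans (cong proj₁ eq) (sym (+ₘ-identityʳ k))))
  D-cancelˡ (k , true) (k′ , false) eq = cong (_, false) (trans (sym (-ₘ-involutive k′))
    (trans (cong -ₘ_ (+ₘ-cancelˡ k (-ₘ k′) zero (trans (cong proj₁ eq) (sym (+ₘ-identityʳ k))))) -ₘ-zero))
  D-cancelˡ (k , false) (k′ , true) eq = contradiction (cong proj₂ eq) λ ()
  D-cancelˡ (k , true)  (k′ , true) eq = contradiction (cong proj₂ eq) λ ()

  π-ε : π ε ≡ 1D
  π-ε = D-cancelˡ (π ε) (π ε) (trans (sym (π-homo ε ε)) (π-cong (identityˡ ε)))

  π-∙-1D : ∀ {g h} → π g ≡ 1D → π (g ∙ h) ≡ π h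
  π-∙-1D {g} {h} eq = trans (π-homo g h) (trans (cong (_·D π h) eq) (D-identityˡ (π h)))

  π-⁻¹-1D : ∀ {g} → π g ≡ 1D → π (g ⁻¹) ≡ 1D
  π-⁻¹-1D {g} eq = trans (sym (π-∙-1D eq)) (trans (π-cong (inverseʳ g)) π-ε)

  π-⋆-1D : ∀ n {g} → π g ≡ 1D → π (n ⋆ g) ≡ 1D
  π-⋆-1D zero    eq = π-ε
  π-⋆-1D (suc n) eq = trans (π-∙-1D eq) (π-⋆-1D n eq)

  π-conj-1D : ∀ s {g} → π g ≡ 1D → π (s ∙ g ∙ s ⁻¹) ≡ 1D
  π-conj-1D s {g} eq = trans (π-homo _ _) (trans (cong (_·D π (s ⁻¹))
    (trans (π-homo s g) (trans (cong (π s ·D_) eq) (D-identityʳ (π s)))))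
    (trans (sym (π-homo _ _)) (trans (π-cong (inverseʳ s)) π-ε)))

  π-//-1D : ∀ {g s} → π g ≡ π s → π (g ∙ s ⁻¹) ≡ 1D
  π-//-1D {g} {s} eq = trans (π-homo _ _) (trans (cong (_·D π (s ⁻¹)) eq)
    (trans (sym (π-homo _ _)) (trans (π-cong (inverseʳ s)) π-ε)))

  kernel : Group c ℓ
  kernel = record
    { Carrier = Σ X λ g → π g ≡ 1D
    ; _≈_ = λ g h → proj₁ g ≈ proj₁ h
    ; _∙_ = λ (g , πg) (h , πh) → g ∙ h , trans (π-∙-1D πg) πh
    ; ε   = ε , π-ε
    ; _⁻¹ = λ (g , πg) → g ⁻¹ , π-⁻¹-1D πg
    ; isGroup = record
      { isMonoid = record
        { isSemigroup = record
          { isMagma = record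
            { isEquivalence = record { refl = ≈-refl ; sym = ≈-sym ; trans = ≈-trans }
            ; ∙-cong = ∙-cong }
          ; assoc = λ (g , _) (h , _) (k , _) → assoc g h k }
        ; identity = (λ (g , _) → identityˡ g) , λ (g , _) → identityʳ g }
      ; inverse = (λ (g , _) → inverseˡ g) , λ (g , _) → inverseʳ g
      ; ⁻¹-cong = ⁻¹-cong } }

  kernel-⋆ : ∀ n (k : Group.Carrier kernel) → proj₁ (Powers._⋆_ kernel n k) ≈ n ⋆ proj₁ k
  kernel-⋆ zero    k = ≈-refl
  kernel-⋆ (suc n) k = ∙-congˡ (kernel-⋆ n k)

  module Section (p : ℕ) (p-prime : Prime p) (2∤p : ¬ (2 ∣ p)) (p∤r : ¬ (p ∣ suc m))
                 (exponent : ∀ {g} → π g ≡ 1D → p ⋆ g ≈ ε) where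

    -- Take the p-th power of any lift `g`. The square of `g` lies in the kernel because reflections
    -- square to the identity, so p being odd keeps the power in the coset of `g`; its own square is
    -- the p-th power of a kernel element.
    involution : ∀ k → ∃ λ g → π g ≡ (k , true) × g ∙ g ≈ ε
    involution k = p ⋆ g , πτ , ττ
      where
      g = proj₁ (π-surjective (k , true))
      πg = proj₂ (π-surjective (k , true))
      h = proj₁ (odd p 2∤p)
      π2g : π (2 ⋆ g) ≡ 1D
      π2g = trans (π-cong (∙-congˡ (identityʳ g))) (trans (π-homo g g)
        (trans (cong₂ _·D_ πg πg) (cong (_, false) (+ₘ-inverseʳ k))))
      πτ : π (p ⋆ g) ≡ (k , true)
      πτ = trans (π-cong (⋆-congˡ (proj₂ (odd p 2∤p)))) (trans (π-homo g ((h * 2) ⋆ g))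
        (trans (cong (π g ·D_) (trans (π-cong (≈-sym (⋆-assoc g h 2))) (π-⋆-1D h π2g)))
          (trans (D-identityʳ (π g)) πg)))
      ττ : p ⋆ g ∙ p ⋆ g ≈ ε
      ττ = ≈-trans (∙-congˡ (≈-sym (identityʳ _))) (≈-trans (⋆-comm 2 p g) (exponent π2g))

    private
      τ = proj₁ (involution zero)
      ω = proj₁ (involution [ 1 ])
      ττ = proj₂ (proj₂ (involution zero))
      ωω = proj₂ (proj₂ (involution [ 1 ]))

      ρ₀ : X
      ρ₀ = ω ∙ τ

      πρ₀ : π ρ₀ ≡ ([ 1 ] , false)
      πρ₀ = trans (π-homo ω τ) (trans (cong₂ _·D_ (proj₁ (proj₂ (involution [ 1 ]))) (proj₁ (proj₂ (involution zero))))
        (cong (_, false) (trans (cong ([ 1 ] +ₘ_) -ₘ-zero) (+ₘ-identityʳ [ 1 ]))))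

      π-⋆-rotation : ∀ n {g} → π g ≡ ([ 1 ] , false) → π (n ⋆ g) ≡ ([ n ] , false)
      π-⋆-rotation zero    eq = π-ε
      π-⋆-rotation (suc n) eq = trans (π-homo _ _) (trans (cong₂ _·D_ eq (π-⋆-rotation n eq))
        (cong (_, false) ([]-+ 1 n)))

      Inverts : X → Set ℓ
      Inverts g = τ ∙ g ≈ g ⁻¹ ∙ τ

      inverts-ρ₀ : Inverts ρ₀
      inverts-ρ₀ = ≈-sym (≈-trans (∙-congʳ (≈-sym (inverseʳ-unique ρ₀ (τ ∙ ω) ρ₀-inverse)))
        (assoc τ ω τ))
        where
        ρ₀-inverse : ω ∙ τ ∙ (τ ∙ ω) ≈ ε
        ρ₀-inverse = ≈-trans (assoc _ _ _) (≈-trans (∙-congˡ (≈-trans (≈-sym (assoc τ τ ω))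
          (≈-trans (∙-congʳ ττ) (identityˡ ω)))) ωω)

      ⋆-sucʳ : ∀ n g → n ⋆ g ∙ g ≈ g ∙ n ⋆ g
      ⋆-sucʳ n g = ≈-trans (∙-congˡ (≈-sym (identityʳ g))) (≈-trans (≈-sym (⋆-homo-+ g n 1))
        (⋆-congˡ (ℕₚ.+-comm n 1)))

      inverts-⋆ : ∀ n {g} → Inverts g → Inverts (n ⋆ g)
      inverts-⋆ zero    inv = ≈-trans (identityʳ τ) (≈-sym (≈-trans (∙-congʳ ε⁻¹≈ε) (identityˡ τ)))
      inverts-⋆ (suc n) {g} inv = ≈-trans (≈-sym (assoc τ g (n ⋆ g))) (≈-trans (∙-congʳ inv)
        (≈-trans (assoc _ _ _) (≈-trans (∙-congˡ (inverts-⋆ n inv)) (≈-trans (≈-sym (assoc _ _ _))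
        (∙-congʳ (≈-trans (≈-sym (⁻¹-anti-homo-∙ (n ⋆ g) g)) (⁻¹-cong (⋆-sucʳ n g))))))))

      0<p : 0 < p
      0<p = >-nonZero⁻¹ p {{prime⇒nonZero p-prime}}

      -- The exponent x p = 1 + y r keeps ρ₀ in its coset and kills the part of its order that divides p.
      x = proj₁ (inverse-mod (prime-∤⇒coprime p-prime p∤r) 0<p)
      y = proj₁ (proj₂ (inverse-mod (prime-∤⇒coprime p-prime p∤r) 0<p))

      ρ : X
      ρ = (x * p) ⋆ ρ₀

      πρ : π ρ ≡ ([ 1 ] , false)
      πρ = trans (π-cong (⋆-congˡ (proj₂ (proj₂ (inverse-mod (prime-∤⇒coprime p-prime p∤r) 0<p)))))
        (trans (π-homo ρ₀ ((y * suc m) ⋆ ρ₀)) (trans (cong₂ _·D_ πρ₀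
          (trans (π-cong (≈-sym (⋆-assoc ρ₀ y (suc m))))
            (π-⋆-1D y (trans (π-⋆-rotation (suc m) πρ₀) (cong (_, false) [n]≡zero)))))
          (D-identityʳ _)))

      -- `suc m ⋆ ρ₀` lies in the kernel, and the factor p contained in the exponent of `ρ` kills
      -- it.
      r⋆ρ : suc m ⋆ ρ ≈ ε
      r⋆ρ = ≈-trans (⋆-comm (suc m) (x * p) ρ₀) (≈-trans (≈-sym (⋆-assoc _ x p))
        (≈-trans (⋆-congʳ x (exponent (trans (π-⋆-rotation (suc m) πρ₀) (cong (_, false) [n]≡zero)))) (⋆-ε x)))

      ξ : Fin (suc m) → X
      ξ k = toℕ k ⋆ ρ

      ξ-homo : ∀ k l → ξ (k +ₘ l) ≈ ξ k ∙ ξ l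
      ξ-homo k l = ≈-trans (⋆-congˡ (toℕ-mod t (suc m))) (≈-trans (≈-sym (identityʳ _))
        (≈-trans (∙-congˡ (≈-sym (≈-trans (≈-sym (⋆-assoc ρ (t / suc m) (suc m)))
          (≈-trans (⋆-congʳ (t / suc m) r⋆ρ) (⋆-ε (t / suc m))))))
        (≈-trans (≈-sym (⋆-homo-+ ρ (t % suc m) _)) (≈-trans (⋆-congˡ (sym (m≡m%n+[m/n]*n t (suc m))))
        (⋆-homo-+ ρ (toℕ k) (toℕ l))))))
        where
        t = toℕ k + toℕ l

      ξ-inverse : ∀ k → ξ (-ₘ k) ≈ ξ k ⁻¹
      ξ-inverse k = inverseˡ-unique _ _ (≈-trans (≈-sym (ξ-homo (-ₘ k) k)) (⋆-congˡ (cong toℕ (+ₘ-inverseˡ k))))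

      τ^ : Bool → X
      τ^ b = if b then τ else ε

      τ^-homo : ∀ b → τ ∙ τ^ b ≈ τ^ (true xor b)
      τ^-homo false = identityʳ τ
      τ^-homo true  = ττ

    section : Dih (suc m) → X
    section (k , b) = ξ k ∙ τ^ b

    section-homo : ∀ d d′ → section (d ·D d′) ≈ section d ∙ section d′
    section-homo (k , false) (k′ , b) = ≈-trans (∙-congʳ (ξ-homo k k′))
      (≈-trans (assoc _ _ _) (∙-congʳ (≈-sym (identityʳ (ξ k)))))
    section-homo (k , true) (k′ , b) = ≈-trans (∙-cong (≈-trans (ξ-homo k (-ₘ k′))
      (∙-congˡ (ξ-inverse k′))) (≈-sym (τ^-homo b)))
      (≈-trans (assoc _ _ _) (≈-trans (∙-congˡ (≈-trans (≈-sym (assoc _ _ _))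
        (≈-trans (∙-congʳ (≈-sym (inverts-⋆ (toℕ k′) (inverts-⋆ (x * p) inverts-ρ₀))))
          (assoc _ _ _)))) (≈-sym (assoc _ _ _))))

    π-section : ∀ d → π (section d) ≡ d
    π-section (k , b) = trans (π-homo (ξ k) (τ^ b)) (trans (cong₂ _·D_
      (trans (π-⋆-rotation (toℕ k) πρ) (cong (_, false) ([toℕ] k))) (πτ b)) (cong (_, b) (+ₘ-identityʳ k)))
      where
      πτ : ∀ b → π (τ^ b) ≡ (zero , b)
      πτ false = π-ε
      πτ true  = proj₁ (proj₂ (involution zero))

record SplitExtension {c ℓ} {G : Group c ℓ} {m} (Q : DihedralQuotient G m) (p n : ℕ) : Set (c Level.⊔ ℓ) where
  open Group G using (_≈_; _∙_) renaming (Carrier to X)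
  open DihedralQuotient Q
  field
    section      : Dih (suc m) → X
    section-homo : ∀ d d′ → section (d ·D d′) ≈ section d ∙ section d′
    π-section    : ∀ d → π (section d) ≡ d
    Φ            : Vec (Fin p) n → X
    π-Φ          : ∀ u → π (Φ u) ≡ 1D
    Φ-homo       : ∀ u w → Φ (u +V w) ≈ Φ u ∙ Φ w
    Φ-injective  : ∀ {u w} → Φ u ≈ Φ w → u ≡ w
    Φ-surjective : ∀ g → π g ≡ 1D → ∃ λ u → Φ u ≈ g

module SemidirectProduct {G : Group c ℓ} {m p n : ℕ} {Q : DihedralQuotient G m}
                         (S : SplitExtension Q p n) where
  open Group G renaming (Carrier to X; refl to ≈-refl; sym to ≈-sym; trans to ≈-trans)
  open Powers G
  open DihedralQuotient Q
  open QuotientProperties Q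
  open SplitExtension S

  private
    κ : ∀ g → π g ≡ 1D → Vec (Fin p) n
    κ g πg = proj₁ (Φ-surjective g πg)

    Φκ : ∀ g πg → Φ (κ g πg) ≈ g
    Φκ g πg = proj₂ (Φ-surjective g πg)

    conj-∙ : ∀ s x y → s ∙ (x ∙ y) ∙ s ⁻¹ ≈ (s ∙ x ∙ s ⁻¹) ∙ (s ∙ y ∙ s ⁻¹)
    conj-∙ s x y = ≈-sym (≈-trans (≈-sym (assoc _ _ _)) (∙-congʳ (≈-trans (assoc _ _ _)
      (≈-trans (∙-congˡ (≈-trans (≈-sym (assoc _ _ _)) (≈-trans (∙-congʳ (inverseˡ s)) (identityˡ y)))) (assoc _ _ _)))))

    conj-conj : ∀ s t x → (s ∙ t) ∙ x ∙ (s ∙ t) ⁻¹ ≈ s ∙ (t ∙ x ∙ t ⁻¹) ∙ s ⁻¹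
    conj-conj s t x = ≈-trans (∙-congˡ (⁻¹-anti-homo-∙ s t)) (≈-trans (≈-sym (assoc _ _ _))
      (∙-congʳ (≈-trans (∙-congʳ (assoc s t x)) (assoc s (t ∙ x) (t ⁻¹)))))

    θ : Dih (suc m) → Vec (Fin p) n → Vec (Fin p) n
    θ d u = κ (section d ∙ Φ u ∙ section d ⁻¹) (π-conj-1D (section d) (π-Φ u))

    Φθ : ∀ d u → Φ (θ d u) ≈ section d ∙ Φ u ∙ section d ⁻¹
    Φθ d u = Φκ _ _

    section-1D : section 1D ≈ ε
    section-1D = ∙-cancelˡ (section 1D) _ _ (≈-trans (≈-sym (section-homo 1D 1D)) (≈-sym (identityʳ _)))

  action : DihAction p n (suc m)
  action = record
    { θ     = θ
    ; θ-add = λ d u w → Φ-injective (≈-trans (Φθ d _) (≈-trans (∙-congʳ (∙-congˡ (Φ-homo u w)))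
        (≈-trans (conj-∙ (section d) (Φ u) (Φ w)) (≈-trans (∙-cong (≈-sym (Φθ d u)) (≈-sym (Φθ d w)))
          (≈-sym (Φ-homo (θ d u) (θ d w)))))))
    ; θ-hom = λ d d′ u → Φ-injective (≈-trans (Φθ _ u)
        (≈-trans (∙-cong (∙-congʳ (section-homo d d′)) (⁻¹-cong (section-homo d d′)))
        (≈-trans (conj-conj (section d) (section d′) (Φ u))
        (≈-trans (∙-congʳ (∙-congˡ (≈-sym (Φθ d′ u)))) (≈-sym (Φθ d _))))))
    ; θ-id  = λ { zero u _ → Φ-injective (≈-trans (Φθ 1D u)
        (≈-trans (∙-cong (≈-trans (∙-congʳ section-1D) (identityˡ (Φ u))) (≈-trans (⁻¹-cong section-1D) ε⁻¹≈ε))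
          (identityʳ (Φ u)))) }
    }

  private
    π-∙-section : ∀ g → π (g ∙ section (π g) ⁻¹) ≡ 1D
    π-∙-section g = π-//-1D (sym (π-section (π g)))

    f : X → ZV p n × Dih (suc m)
    f g = κ (g ∙ section (π g) ⁻¹) (π-∙-section g) , π g

    Φf : ∀ g → Φ (proj₁ (f g)) ∙ section (π g) ≈ g
    Φf g = ≈-trans (∙-congʳ (Φκ _ _)) (≈-trans (assoc _ _ _) (≈-trans (∙-congˡ (inverseˡ _)) (identityʳ g)))

    f-unique : ∀ g u → Φ u ∙ section (π g) ≈ g → proj₁ (f g) ≡ u
    f-unique g u eq = Φ-injective (∙-cancelʳ (section (π g)) _ _ (≈-trans (Φf g) (≈-sym eq)))

    SD-section : ∀ u d u′ d′ → Φ (u +V θ d u′) ∙ section (d ·D d′) ≈ (Φ u ∙ section d) ∙ (Φ u′ ∙ section d′)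
    SD-section u d u′ d′ = ≈-trans (∙-cong (≈-trans (Φ-homo u (θ d u′)) (∙-congˡ (Φθ d u′))) (section-homo d d′))
      (≈-trans (assoc _ _ _) (≈-trans (∙-congˡ (≈-trans (assoc _ _ _) (≈-trans (∙-congˡ (≈-trans (≈-sym (assoc _ _ _))
        (≈-trans (∙-congʳ (inverseˡ _)) (identityˡ _)))) (assoc _ _ _)))) (≈-sym (assoc _ _ _))))

  isomorphism : IsoToSD G action
  isomorphism = record
    { f      = f
    ; f-cong = λ {g} {h} g≈h → cong₂ _,_ (f-unique g _ (≈-trans (≈-trans (∙-congˡ
                 (reflexive (cong section (π-cong g≈h)))) (Φf h)) (≈-sym g≈h))) (π-cong g≈h)
    ; f-inj  = λ g h eq → ≈-trans (≈-sym (Φf g)) (≈-trans (reflexive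
                 (cong (λ (u , d) → Φ u ∙ section d) eq)) (Φf h))
    ; f-surj = λ (u , d) → Φ u ∙ section d , cong₂ _,_
                 (f-unique (Φ u ∙ section d) u (∙-congˡ (reflexive (cong section (π-Φ-section u d))))) (π-Φ-section u d)
    ; f-hom  = λ g h → cong₂ _,_ (f-unique (g ∙ h) _ (≈-trans (∙-congˡ (reflexive (cong section (π-homo g h))))
                 (≈-trans (SD-section (proj₁ (f g)) (π g) (proj₁ (f h)) (π h)) (∙-cong (Φf g) (Φf h))))) (π-homo g h)
    }
    where
    π-Φ-section : ∀ u d → π (Φ u ∙ section d) ≡ d
    π-Φ-section u d = trans (π-∙-1D (π-Φ u)) (π-section d)

module KernelCoordinates {G : Group c ℓ} {m q n : ℕ} (Q : DihedralQuotient G m)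
  (p-prime : Prime (suc (suc q))) (2∤p : ¬ (2 ∣ suc (suc q))) (p∤r : ¬ (suc (suc q) ∣ suc m))
  (α : Fin n → Action (QuotientProperties.kernel Q) (Fin (suc (suc q))))
  (transitive : ∀ (t : Vec (Fin (suc (suc q))) n) →
                ∃ λ k → ∀ j → Action.act (α j) k zero ≡ lookup t j)
  (free : ∀ k → (∀ j → Action.act (α j) k zero ≡ zero) →
          Group._≈_ (QuotientProperties.kernel Q) k (Group.ε (QuotientProperties.kernel Q)))
  where
  open Group G renaming (Carrier to X; refl to ≈-refl; sym to ≈-sym; trans to ≈-trans)
  open Powers G
  open DihedralQuotient Q
  open QuotientProperties Q

  private
    module K = ElementaryAbelian kernel p-prime α transitive free

    p : ℕ
    p = suc (suc q)

    exponent : ∀ {g} → π g ≡ 1D → p ⋆ g ≈ ε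
    exponent {g} πg = ≈-trans (≈-sym (kernel-⋆ p (g , πg))) (K.exponent (g , πg))

    module S = Section p p-prime 2∤p p∤r exponent

  splitExtension : SplitExtension Q p n
  splitExtension = record
    { section      = S.section
    ; section-homo = S.section-homo
    ; π-section    = S.π-section
    ; Φ            = λ u → proj₁ (K.Φ u)
    ; π-Φ          = λ u → proj₂ (K.Φ u)
    ; Φ-homo       = K.Φ-homo
    ; Φ-injective  = K.Φ-injective
    ; Φ-surjective = λ g πg → K.Φ-surjective (g , πg)
    }

-- Groups acting on directed edges

Edge : ℕ → ℕ → ℕ → Set
Edge p r s = Fin r × Vec (Fin p) (suc s)

Follow : ∀ {p r s} → Edge p r s → Edge p r s → Set
Follow (i , x) (j , y) = sucₘ i ≡ j × tail x ≡ init y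

lookup-init : ∀ {A : Set a} {n} (x : Vec A (suc n)) j → lookup (init x) j ≡ lookup x (inject₁ j)
lookup-init (_ ∷ _ ∷ _) zero    = refl
lookup-init (_ ∷ y ∷ x) (suc j) = lookup-init (y ∷ x) j

lookup-tail : ∀ {A : Set a} {n} (x : Vec A (suc n)) j → lookup (tail x) j ≡ lookup x (suc j)
lookup-tail (_ ∷ _) j = refl

follow-lookup : ∀ {p r s} (e e′ : Edge p r s) → Follow e e′ → ∀ j →
                lookup (proj₂ e) (suc j) ≡ lookup (proj₂ e′) (inject₁ j)
follow-lookup (_ , x) (_ , y) (_ , eq) j =
  trans (sym (lookup-tail x j)) (trans (cong (λ v → lookup v j) eq) (lookup-init y j))

module Connected (q m s : ℕ) where
  open Modular m

  private
    E : Set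
    E = Edge (suc q) (suc m) s

    ZeroFrom : ∀ {n} → ℕ → Vec (Fin (suc q)) n → Set
    ZeroFrom _       []      = ⊤
    ZeroFrom zero    (x ∷ v) = x ≡ zero × ZeroFrom zero v
    ZeroFrom (suc k) (x ∷ v) = ZeroFrom k v

    zeroFrom-∷ʳ : ∀ {n} k (v : Vec (Fin (suc q)) n) → ZeroFrom k v → ZeroFrom k (v ∷ʳ zero)
    zeroFrom-∷ʳ zero    []      _        = refl , tt
    zeroFrom-∷ʳ (suc k) []      _        = tt
    zeroFrom-∷ʳ zero    (x ∷ v) (x≡0 , z) = x≡0 , zeroFrom-∷ʳ zero v z
    zeroFrom-∷ʳ (suc k) (x ∷ v) z        = zeroFrom-∷ʳ k v z

    zeroFrom-end : ∀ {n} (v : Vec (Fin (suc q)) n) → ZeroFrom n v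
    zeroFrom-end []      = tt
    zeroFrom-end (_ ∷ v) = zeroFrom-end v

    zeroFrom-start : ∀ {n} (v : Vec (Fin (suc q)) n) → ZeroFrom 0 v → v ≡ replicate n zero
    zeroFrom-start []      _         = refl
    zeroFrom-start (x ∷ v) (x≡0 , z) = cong₂ _∷_ x≡0 (zeroFrom-start v z)

    zeroFrom-replicate : ∀ n → ZeroFrom 0 (replicate n zero)
    zeroFrom-replicate zero    = tt
    zeroFrom-replicate (suc n) = refl , zeroFrom-replicate n

  shift : E → E
  shift (i , x) = sucₘ i , tail x ∷ʳ zero

  follow-shift : ∀ e → Follow e (shift e)
  follow-shift (i , x) = refl , sym (init-∷ʳ zero (tail x))

  zeros : Fin (suc m) → E
  zeros i = i , replicate (suc s) zero

  follow-zeros : ∀ i → Follow (zeros i) (zeros (sucₘ i))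
  follow-zeros i = subst (Follow (zeros i)) (cong (sucₘ i ,_)
    (zeroFrom-start _ (zeroFrom-∷ʳ 0 (tail z) (proj₂ (zeroFrom-replicate (suc s)))))) (follow-shift (zeros i))
    where
    z = replicate (suc s) zero

  module _ {ℓ} (P : E → Set ℓ) (forward : ∀ {e e′} → Follow e e′ → P e → P e′)
           (backward : ∀ {e e′} → Follow e e′ → P e′ → P e) where

    private
      toZeros : ∀ k i x → ZeroFrom k x → P (i , x) → ∃ λ j → P (zeros j)
      toZeros zero    i x       z px = i , subst (λ v → P (i , v)) (zeroFrom-start x z) px
      toZeros (suc k) i x@(_ ∷ v) z px = toZeros k _ _ (zeroFrom-∷ʳ k v z) (forward (follow-shift (i , x)) px)

      fromZeros : ∀ k i x → ZeroFrom k x → (∀ j → P (zeros j)) → P (i , x)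
      fromZeros zero    i x         z pz = subst (λ v → P (i , v)) (sym (zeroFrom-start x z)) (pz i)
      fromZeros (suc k) i x@(_ ∷ v) z pz = backward (follow-shift (i , x)) (fromZeros k _ _ (zeroFrom-∷ʳ k v z) pz)

      spread : ∀ k i → P (zeros i) → P (zeros (sucₘ^ k i))
      spread zero    i pz = pz
      spread (suc k) i pz = forward (follow-zeros _) (spread k i pz)

    -- Appending zeros `suc s` times leads forward from any edge to an all-zero tuple. The all-zero
    -- edges form a closed walk through every index, and the same shifts, retraced backwards, reach
    -- `e′`.
    connected : ∀ {e} → P e → ∀ e′ → P e′
    connected {i , x} px (i′ , x′) = fromZeros (suc s) i′ x′ (zeroFrom-end x′) λ j →
      let i₀ , pz = toZeros (suc s) i x (zeroFrom-end x) px
          k , eq = sucₘ^-reaches i₀ j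
      in subst (P ∘ zeros) eq (spread k i₀ pz)

-- Arc-regularity in terms of edges alone: an arc is an edge with one of two directions, whence the
-- `Bool` in `transitive`. Vertices are left out so that the simple cycle of length pr, which has pr
-- vertices instead of r, also fits.
record DirectedAction {c ℓ} (G : Group c ℓ) (p r s : ℕ) : Set (c Level.⊔ ℓ) where
  open Group G using (_≈_; ε) renaming (Carrier to X)
  field
    action : Action G (Edge p r s)
  open Action action public
  field
    reverses   : X → Bool
    preserve   : ∀ g → reverses g ≡ false → ∀ {e e′} → Follow e e′ → Follow (act g e) (act g e′)
    reverse    : ∀ g → reverses g ≡ true → ∀ {e e′} → Follow e e′ → Follow (act g e′) (act g e)
    transitive : ∀ b e e′ → ∃ λ g → reverses g ≡ b × act g e ≡ e′
    free       : ∀ g e → reverses g ≡ false → act g e ≡ e → g ≈ ε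

module DirectedActionProperties {G : Group c ℓ} {q m s : ℕ} (3≤r : 3 ≤ suc m)
  (D : DirectedAction G (suc (suc q)) (suc m) s) where
  open Group G using (_≈_; _∙_; ε) renaming (Carrier to X)
  open DirectedAction D
  open Modular m
  open Connected (suc q) m s

  private
    E : Set
    E = Edge (suc (suc q)) (suc m) s

    index : E → Fin (suc m)
    index = proj₁

  signed : Bool → Fin (suc m) → Fin (suc m)
  signed b k = if b then -ₘ k else k

  signed-+ : ∀ b k l → signed b (k +ₘ l) ≡ signed b k +ₘ signed b l
  signed-+ false k l = refl
  signed-+ true  k l = sym (-ₘ-+ₘ-comm k l)

  signed-xor : ∀ b b′ k → signed b (signed b′ k) ≡ signed (b xor b′) k
  signed-xor false b′    k = refl
  signed-xor true  false k = refl
  signed-xor true  true  k = -ₘ-involutive k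

  [1]≢-[1] : [ 1 ] ≢ -ₘ [ 1 ]
  [1]≢-[1] eq = sucₘsucₘ≢ 3≤r {zero} (trans (sucₘ^-+ 2 zero) (trans (+ₘ-identityʳ [ 2 ])
    (trans (sym ([]-+ 1 1)) (trans (cong ([ 1 ] +ₘ_) eq) (+ₘ-inverseʳ [ 1 ])))))

  signed-injective : ∀ b b′ → signed b [ 1 ] ≡ signed b′ [ 1 ] → b ≡ b′
  signed-injective false false eq = refl
  signed-injective false true  eq = contradiction eq [1]≢-[1]
  signed-injective true  false eq = contradiction (sym eq) [1]≢-[1]
  signed-injective true  true  eq = refl

  offset : X → Fin (suc m)
  offset g = index (act g (zeros zero))

  -- Indices of consecutive edges differ by one, and `g` keeps or flips the order of consecutive
  -- edges, so connectedness propagates the formula from `zeros zero`.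
  index-act : ∀ g e → index (act g e) ≡ offset g +ₘ signed (reverses g) (index e)
  index-act g with reverses g in dir
  ... | false = connected (λ e → index (act g e) ≡ offset g +ₘ index e)
        (λ { {i , _} {_ , _} (refl , eq) h → trans (sym (proj₁ (preserve g dir (refl , eq))))
               (trans (cong sucₘ h) (sucₘ-+ʳ (offset g) i)) })
        (λ { {i , _} {_ , _} (refl , eq) h → sucₘ-injective (trans (proj₁ (preserve g dir (refl , eq)))
               (trans h (sym (sucₘ-+ʳ (offset g) i)))) })
        (sym (+ₘ-identityʳ (offset g)))
  ... | true  = connected (λ e → index (act g e) ≡ offset g +ₘ (-ₘ index e))
        (λ { {i , _} {_ , _} (refl , eq) h → sucₘ-injective (trans (proj₁ (reverse g dir (refl , eq)))
               (trans h (sym (sucₘ-neg (offset g) i)))) })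
        (λ { {i , _} {_ , _} (refl , eq) h → trans (sym (proj₁ (reverse g dir (refl , eq))))
               (trans (cong sucₘ h) (sucₘ-neg (offset g) i)) })
        (sym (trans (cong (offset g +ₘ_) -ₘ-zero) (+ₘ-identityʳ (offset g))))

  offset-∙ : ∀ g h → offset (g ∙ h) ≡ offset g +ₘ signed (reverses g) (offset h)
  offset-∙ g h = trans (cong index (act-∙ g h (zeros zero))) (index-act g (act h (zeros zero)))

  -- `reverses` is given only as a Boolean function. Its multiplicativity is recovered from the
  -- action on indices, where the two signs can be told apart since 1 and -1 differ modulo r ≥ 3.
  reverses-∙ : ∀ g h → reverses (g ∙ h) ≡ reverses g xor reverses h
  reverses-∙ g h = signed-injective _ _ (+ₘ-cancelˡ (offset (g ∙ h)) _ _ (trans (sym (index-act (g ∙ h) (zeros [ 1 ])))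
    (trans (cong index (act-∙ g h (zeros [ 1 ]))) (trans (index-act g _) (trans (cong (λ k → offset g +ₘ signed (reverses g) k)
      (index-act h (zeros [ 1 ]))) (trans (cong (offset g +ₘ_) (signed-+ (reverses g) (offset h) _))
      (trans (sym (+ₘ-assoc (offset g) _ _)) (cong₂ _+ₘ_ (sym (offset-∙ g h))
        (signed-xor (reverses g) (reverses h) [ 1 ])))))))))

  offset-cong : ∀ {g h} → g ≈ h → offset g ≡ offset h
  offset-cong g≈h = cong index (act-cong g≈h (zeros zero))

  reverses-cong : ∀ {g h} → g ≈ h → reverses g ≡ reverses h
  reverses-cong {g} {h} g≈h = signed-injective _ _ (+ₘ-cancelˡ (offset g) _ _ (trans (sym (index-act g (zeros [ 1 ])))
    (trans (cong index (act-cong g≈h (zeros [ 1 ]))) (trans (index-act h (zeros [ 1 ]))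
      (cong (_+ₘ signed (reverses h) [ 1 ]) (sym (offset-cong g≈h)))))))

  quotient : DihedralQuotient G m
  quotient = record
    { π            = λ g → offset g , reverses g
    ; π-cong       = λ g≈h → cong₂ _,_ (offset-cong g≈h) (reverses-cong g≈h)
    ; π-homo       = λ g h → cong₂ _,_ (offset-∙ g h) (reverses-∙ g h)
    ; π-surjective = λ (k , b) → let g , dir , eq = transitive b (zeros zero) (zeros k)
                                 in g , cong₂ _,_ (cong index eq) dir
    }

  open QuotientProperties quotient using (kernel)

  private
    K : Set _
    K = Group.Carrier kernel

    coord : E → Fin (suc s) → Fin (suc (suc q))
    coord e = lookup (proj₂ e)

  kernel-preserve : ∀ (k : K) e e′ → Follow e e′ → Follow (act (proj₁ k) e) (act (proj₁ k) e′)
  kernel-preserve (g , πg) _ _ = preserve g (cong proj₂ πg)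

  kernel-index : ∀ (k : K) e → index (act (proj₁ k) e) ≡ index e
  kernel-index (g , πg) e = trans (index-act g e) (trans (cong₂ (λ o b → o +ₘ signed b (index e))
    (cong proj₁ πg) (cong proj₂ πg)) (+ₘ-identityˡ (index e)))

  private
    -- Each step backwards from (i , x) drops the last coordinate, until only the prefix is left.
    coord-prefix : ∀ (k : K) j i {x x′} → (∀ l → l ≤ᶠ j → lookup x l ≡ lookup x′ l) →
                   coord (act (proj₁ k) (i , x)) j ≡ coord (act (proj₁ k) (i , x′)) j
    coord-prefix k = >-weakInduction _
      (λ i agree → cong (λ v → coord (act (proj₁ k) (i , v)) (fromℕ s)) (lookup-ext (λ l → agree l (≤fromℕ l))))
      λ j ih i {x} {x′} agree →
        let i⁻ , suc≡i = predₘ i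
            step = λ v → follow-lookup (act (proj₁ k) (i⁻ , zero ∷ init v)) (act (proj₁ k) (i , v)) (kernel-preserve k (i⁻ , zero ∷ init v) (i , v) (suc≡i , refl)) j
        in trans (sym (step x)) (trans (ih i⁻ (agree′ j x x′ agree)) (step x′))
      where
      agree′ : ∀ j (x x′ : Vec (Fin (suc (suc q))) (suc s)) → (∀ l → l ≤ᶠ inject₁ j → lookup x l ≡ lookup x′ l) →
               ∀ l → l ≤ᶠ suc j → lookup (zero ∷ init x) l ≡ lookup (zero ∷ init x′) l
      agree′ j x x′ agree zero _ = refl
      agree′ j x x′ agree (suc l) (s≤s l≤j) = trans (lookup-init x l) (trans
        (agree (inject₁ l) (≡.subst₂ _≤_ (sym (toℕ-inject₁ l)) (sym (toℕ-inject₁ j)) l≤j)) (sym (lookup-init x′ l)))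

  -- Coordinate `suc j` of an edge is coordinate `inject₁ j` of any edge following it, before and
  -- after applying `k`. Stepping forward thus reduces to the first coordinate, which is its own
  -- prefix, so that `coord-prefix` applies.
  coordinatewise : ∀ (k : K) j i {x x′} → lookup x j ≡ lookup x′ j →
                   coord (act (proj₁ k) (i , x)) j ≡ coord (act (proj₁ k) (i , x′)) j
  coordinatewise k = <-weakInduction _
    (λ i eq → coord-prefix k zero i λ { zero _ → eq })
    λ j ih i {x} {x′} eq →
      let step  = λ v → follow-lookup (act (proj₁ k) (i , v)) _ (kernel-preserve k (i , v) _ (follow-shift (i , v))) j
          next  = λ v → follow-lookup (i , v) _ (follow-shift (i , v)) j
      in trans (step x) (trans (ih (sucₘ i) (trans (sym (next x)) (trans eq (next x′)))) (sym (step x′)))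

  private
    constant : Fin (suc (suc q)) → E
    constant a = zero , replicate (suc s) a

    -- The constant tuple is merely a carrier of the value `a`. Its image need not be constant; the
    -- composition law holds because only coordinate `j` and the index, which the kernel fixes,
    -- matter.
    coordAction : Fin (suc s) → Action kernel (Fin (suc (suc q)))
    coordAction j = record
      { act      = λ k a → coord (act (proj₁ k) (constant a)) j
      ; act-cong = λ k≈l a → cong (λ e → coord e j) (act-cong k≈l (constant a))
      ; act-ε    = λ a → trans (cong (λ e → coord e j) (act-ε (constant a))) (lookup-replicate j a)
      ; act-∙    = λ k l a → trans (cong (λ e → coord e j) (act-∙ (proj₁ k) (proj₁ l) (constant a)))
          (trans (cong (λ i → coord (act (proj₁ k) (i , proj₂ (act (proj₁ l) (constant a)))) j) (kernel-index l (constant a)))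
            (coordinatewise k j zero (sym (lookup-replicate j _))))
      }

    -- The image of `zeros zero` and the direction bit determine the class in the dihedral group, so
    -- a direction-preserving element sending it to another edge of index zero lies in the kernel.
    coord-transitive : ∀ (t : Vec (Fin (suc (suc q))) (suc s)) →
                       ∃ λ k → ∀ j → Action.act (coordAction j) k zero ≡ lookup t j
    coord-transitive t = let g , dir , eq = transitive false (zeros zero) (zero , t) in
      (g , cong₂ _,_ (cong index eq) dir) , λ j → cong (λ e → coord e j) eq

    coord-free : ∀ k → (∀ j → Action.act (coordAction j) k zero ≡ zero) → proj₁ k ≈ ε
    coord-free k@(g , πg) fixed = free g (zeros zero) (cong proj₂ πg)
      (cong₂ _,_ (cong proj₁ πg) (lookup-ext λ j → trans (fixed j) (sym (lookup-replicate j zero))))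

  semidirect : Prime (suc (suc q)) → ¬ (2 ∣ suc (suc q)) → ¬ (suc (suc q) ∣ suc m) →
               Σ (DihAction (suc (suc q)) (suc s) (suc m)) (λ θ → IsoToSD G θ)
  semidirect p-prime 2∤p p∤r = SD.action , SD.isomorphism
    where
    module KC = KernelCoordinates quotient p-prime 2∤p p∤r coordAction coord-transitive coord-free
    module SD = SemidirectProduct KC.splitExtension

-- Orientation of multigraphs and Praeger–Xu graphs

open Multigraph

-- Two tails of edges with a common head, or two heads of edges with a common tail.
Fork : (Γ : Multigraph) → V Γ → V Γ → Set
Fork Γ u u′ = ∃₂ λ y y′ →
    (end₂ Γ y ≡ end₂ Γ y′ × end₁ Γ y ≡ u × end₁ Γ y′ ≡ u′)
  ⊎ (end₁ Γ y ≡ end₁ Γ y′ × end₂ Γ y ≡ u × end₂ Γ y′ ≡ u′)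

Ends : (Γ : Multigraph) → E Γ → V Γ → V Γ → Set
Ends Γ e u w = (end₁ Γ e ≡ u × end₂ Γ e ≡ w) ⊎ (end₁ Γ e ≡ w × end₂ Γ e ≡ u)

Adj : (Γ : Multigraph) → V Γ → V Γ → Set
Adj Γ u w = ∃ λ e → Ends Γ e u w

module AutActionProperties {G : Group c ℓ} {Γ : Multigraph} (A : AutAction G Γ) where
  open Group G using (_≈_; _∙_; ε; _⁻¹) renaming (Carrier to X)
  open AutAction A

  vertexAction : Action G (V Γ)
  vertexAction = record { act = actV ; act-cong = actV-cong ; act-ε = actV-ε ; act-∙ = actV-∙ }

  edgeAction : Action G (E Γ)
  edgeAction = record { act = actE ; act-cong = actE-cong ; act-ε = actE-ε ; act-∙ = actE-∙ }

  open ActionProperties vertexAction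

  ends-act : ∀ g {e u w} → Ends Γ e u w → Ends Γ (actE g e) (actV g u) (actV g w)
  ends-act g {e} (inj₁ (refl , refl)) = incidence g e
  ends-act g {e} (inj₂ (refl , refl)) = Sum.swap (incidence g e)

  adj-act : ∀ g {u w} → Adj Γ u w → Adj Γ (actV g u) (actV g w)
  adj-act g (e , ends) = actE g e , ends-act g {e} ends

  adj-⁻¹ : ∀ g {u w} → Adj Γ (actV g u) w → Adj Γ u (actV (g ⁻¹) w)
  adj-⁻¹ g {u} adj = subst (λ v → Adj Γ v _) (act-⁻¹ˡ g u) (adj-act (g ⁻¹) adj)

  Forward Backward : X → E Γ → Set
  Forward g e  = end₁ Γ (actE g e) ≡ actV g (end₁ Γ e) × end₂ Γ (actE g e) ≡ actV g (end₂ Γ e)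
  Backward g e = end₁ Γ (actE g e) ≡ actV g (end₂ Γ e) × end₂ Γ (actE g e) ≡ actV g (end₁ Γ e)

  -- The local obstruction to mixed behaviour: were `g` to keep the direction of one of two
  -- consecutive edges and reverse the other, the outer ends of this path would be sent to the ends
  -- of a fork.
  Unfolded : Set c
  Unfolded = ∀ g {e e′} → end₂ Γ e ≡ end₁ Γ e′ → ¬ Fork Γ (actV g (end₁ Γ e)) (actV g (end₂ Γ e′))

  -- Connectedness along directed paths, traversed either way, stated as an induction principle on
  -- edges.
  Connects : Set₁
  Connects = (P : E Γ → Set) → (∀ {e e′} → end₂ Γ e ≡ end₁ Γ e′ → P e → P e′) →
             (∀ {e e′} → end₂ Γ e ≡ end₁ Γ e′ → P e′ → P e) → ∀ {e} → P e → ∀ e′ → P e′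

  module Orientation (regular : ArcRegular) (loopless : ∀ e → end₁ Γ e ≢ end₂ Γ e)
                     (unfolded : Unfolded) (connects : Connects) (e₀ : E Γ) where

    private
      ¬forward-backward : ∀ g {e e′} → end₂ Γ e ≡ end₁ Γ e′ → Forward g e → ¬ Backward g e′
      ¬forward-backward g eq (e₁ , e₂) (e₁′ , e₂′) = unfolded g eq (_ , _ , inj₁
        (trans e₂ (trans (cong (actV g) eq) (sym e₂′)) , e₁ , e₁′))

      ¬backward-forward : ∀ g {e e′} → end₂ Γ e ≡ end₁ Γ e′ → Backward g e → ¬ Forward g e′
      ¬backward-forward g eq (e₁ , e₂) (e₁′ , e₂′) = unfolded g eq (_ , _ , inj₂
        (trans e₁ (trans (cong (actV g) eq) (sym e₁′)) , e₂ , e₂′))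

      forward-everywhere : ∀ g → Forward g e₀ → ∀ e → Forward g e
      forward-everywhere g = connects (Forward g)
        (λ {e} {e′} eq fwd → [ (λ f → f) , (λ b → contradiction b (¬forward-backward g eq fwd)) ]′ (incidence g e′))
        (λ {e} {e′} eq fwd → [ (λ f → f) , (λ b → contradiction fwd (¬backward-forward g eq b)) ]′ (incidence g e))

      backward-everywhere : ∀ g → Backward g e₀ → ∀ e → Backward g e
      backward-everywhere g = connects (Backward g)
        (λ {e} {e′} eq bwd → [ (λ f → contradiction f (¬backward-forward g eq bwd)) , (λ b → b) ]′ (incidence g e′))
        (λ {e} {e′} eq bwd → [ (λ f → contradiction bwd (¬forward-backward g eq f)) , (λ b → b) ]′ (incidence g e))

    reverses : X → Bool
    reverses g = [ (λ _ → false) , (λ _ → true) ]′ (incidence g e₀)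

    forward : ∀ g → reverses g ≡ false → ∀ e → Forward g e
    forward g eq with incidence g e₀
    ... | inj₁ fwd = forward-everywhere g fwd

    backward : ∀ g → reverses g ≡ true → ∀ e → Backward g e
    backward g eq with incidence g e₀
    ... | inj₂ bwd = backward-everywhere g bwd

    -- The direction is imposed by the choice of arcs: tail to tail for `false`, tail to head for
    -- `true`. An element of the wrong direction would identify the two ends of `e`, against
    -- looplessness.
    oriented-transitive : ∀ b e e′ → ∃ λ g → reverses g ≡ b × actE g e ≡ e′
    oriented-transitive false e e′
      with g , eqV , eqE ← proj₁ regular (end₁ Γ e , e , inj₁ refl) (end₁ Γ e′ , e′ , inj₁ refl)
      with reverses g in dir
    ... | false = g , dir , eqE
    ... | true  = contradiction (act-injective g (trans eqV (trans (cong (end₁ Γ) (sym eqE)) (proj₁ (backward g dir e)))))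
                    (loopless e)
    oriented-transitive true e e′
      with g , eqV , eqE ← proj₁ regular (end₁ Γ e , e , inj₁ refl) (end₂ Γ e′ , e′ , inj₂ refl)
      with reverses g in dir
    ... | true  = g , dir , eqE
    ... | false = contradiction (act-injective g (trans eqV (trans (cong (end₂ Γ) (sym eqE)) (proj₂ (forward g dir e)))))
                    (loopless e)

    oriented-free : ∀ g e → reverses g ≡ false → actE g e ≡ e → g ≈ ε
    oriented-free g e dir eq = proj₂ regular g (end₁ Γ e , e , inj₁ refl)
      (trans (sym (proj₁ (forward g dir e))) (cong (end₁ Γ) eq) , eq)

-- Edges may be flipped, since `to-incidence` only compares unordered ends; relabelling K_{2p,2p}
-- does not respect the chosen directions.
record _≅_ (Γ Δ : Multigraph) : Set where
  field
    toV     : V Γ → V Δ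
    fromV   : V Δ → V Γ
    toV-fromV : ∀ v → toV (fromV v) ≡ v
    fromV-toV : ∀ v → fromV (toV v) ≡ v
    toE     : E Γ → E Δ
    fromE   : E Δ → E Γ
    toE-fromE : ∀ e → toE (fromE e) ≡ e
    fromE-toE : ∀ e → fromE (toE e) ≡ e
    to-incidence : ∀ e → Ends Δ (toE e) (toV (end₁ Γ e)) (toV (end₂ Γ e))

module Transport {G : Group c ℓ} {Γ Δ : Multigraph} (ι : Γ ≅ Δ) (A : AutAction G Γ) where
  open AutAction A
  open AutActionProperties A using (ends-act)
  open _≅_ ι

  private
    to-ends : ∀ {e u w} → Ends Γ e u w → Ends Δ (toE e) (toV u) (toV w)
    to-ends {e} (inj₁ (refl , refl)) = to-incidence e
    to-ends {e} (inj₂ (refl , refl)) = Sum.swap (to-incidence e)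

    from-ends : ∀ {e u w} → Ends Δ e u w → Ends Γ (fromE e) (fromV u) (fromV w)
    from-ends {e} {u} {w} ends with to-incidence (fromE e)
    ... | inj₁ (e₁ , e₂) = go ends
      where
      back₁ : end₁ Γ (fromE e) ≡ fromV (end₁ Δ e)
      back₁ = trans (sym (fromV-toV _)) (cong fromV (trans (sym e₁) (cong (end₁ Δ) (toE-fromE e))))
      back₂ : end₂ Γ (fromE e) ≡ fromV (end₂ Δ e)
      back₂ = trans (sym (fromV-toV _)) (cong fromV (trans (sym e₂) (cong (end₂ Δ) (toE-fromE e))))
      go : Ends Δ e u w → Ends Γ (fromE e) (fromV u) (fromV w)
      go (inj₁ (refl , refl)) = inj₁ (back₁ , back₂)
      go (inj₂ (refl , refl)) = inj₂ (back₁ , back₂)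
    ... | inj₂ (e₁ , e₂) = go ends
      where
      back₁ : end₂ Γ (fromE e) ≡ fromV (end₁ Δ e)
      back₁ = trans (sym (fromV-toV _)) (cong fromV (trans (sym e₁) (cong (end₁ Δ) (toE-fromE e))))
      back₂ : end₁ Γ (fromE e) ≡ fromV (end₂ Δ e)
      back₂ = trans (sym (fromV-toV _)) (cong fromV (trans (sym e₂) (cong (end₂ Δ) (toE-fromE e))))
      go : Ends Δ e u w → Ends Γ (fromE e) (fromV u) (fromV w)
      go (inj₁ (refl , refl)) = inj₂ (back₂ , back₁)
      go (inj₂ (refl , refl)) = inj₁ (back₂ , back₁)

  transport : AutAction G Δ
  transport = record
    { actV = λ g v → toV (actV g (fromV v))
    ; actE = λ g e → toE (actE g (fromE e))
    ; actV-cong = λ g≈h v → cong toV (actV-cong g≈h (fromV v))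
    ; actE-cong = λ g≈h e → cong toE (actE-cong g≈h (fromE e))
    ; actV-ε = λ v → trans (cong toV (actV-ε _)) (toV-fromV v)
    ; actE-ε = λ e → trans (cong toE (actE-ε _)) (toE-fromE e)
    ; actV-∙ = λ g h v → cong toV (trans (actV-∙ g h _) (cong (actV g) (sym (fromV-toV _))))
    ; actE-∙ = λ g h e → cong toE (trans (actE-∙ g h _) (cong (actE g) (sym (fromE-toE _))))
    ; incidence = λ g e → to-ends (ends-act g (from-ends {e} (inj₁ (refl , refl))))
    ; faithful = λ g fixV fixE → faithful g
        (λ v → fromTo toV fromV fromV-toV (trans (cong (λ w → toV (actV g w)) (sym (fromV-toV v))) (fixV (toV v))))
        (λ e → fromTo toE fromE fromE-toE (trans (cong (λ w → toE (actE g w)) (sym (fromE-toE e))) (fixE (toE e))))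
    }
    where
    fromTo : ∀ {B C : Set} (to : B → C) (from : C → B) → (∀ x → from (to x) ≡ x) →
             ∀ {x y} → to x ≡ to y → x ≡ y
    fromTo to from ft {x} {y} eq = trans (sym (ft x)) (trans (cong from eq) (ft y))

  private
    from-arc : Arc Δ → Arc Γ
    from-arc (v , e , v∈e) = fromV v , fromE e , ends v∈e (from-ends {e} (inj₁ (refl , refl)))
      where
      ends : v ≡ end₁ Δ e ⊎ v ≡ end₂ Δ e → Ends Γ (fromE e) (fromV (end₁ Δ e)) (fromV (end₂ Δ e)) →
             fromV v ≡ end₁ Γ (fromE e) ⊎ fromV v ≡ end₂ Γ (fromE e)
      ends (inj₁ refl) (inj₁ (e₁ , e₂)) = inj₁ (sym e₁)
      ends (inj₁ refl) (inj₂ (e₁ , e₂)) = inj₂ (sym e₂)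
      ends (inj₂ refl) (inj₁ (e₁ , e₂)) = inj₂ (sym e₂)
      ends (inj₂ refl) (inj₂ (e₁ , e₂)) = inj₁ (sym e₁)

  transport-regular : ArcRegular → AutAction.ArcRegular transport
  transport-regular (transitive , free) =
    (λ a b → let g , eqV , eqE = transitive (from-arc a) (from-arc b)
             in g , trans (cong toV eqV) (toV-fromV _) , trans (cong toE eqE) (toE-fromE _)) ,
    λ g a (eqV , eqE) → free g (from-arc a)
      (trans (sym (fromV-toV _)) (cong fromV eqV) , trans (sym (fromE-toE _)) (cong fromE eqE))

module PXGraph (q m s : ℕ) (3≤r : 3 ≤ suc m) where
  open Modular m

  private
    p : ℕ
    p = suc (suc q)

    Γ : Multigraph
    Γ = PX p (suc m) s

    index : V Γ → Fin (suc m)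
    index = proj₁

  step-index : ∀ {e e′} → end₂ Γ e ≡ end₁ Γ e′ → index (end₂ Γ e′) ≡ sucₘ (sucₘ (index (end₁ Γ e)))
  step-index eq = cong sucₘ (sym (cong index eq))

  fork-index : ∀ {u u′} → Fork Γ u u′ → index u ≡ index u′
  fork-index (y , y′ , inj₁ (eq , refl , refl)) = sucₘ-injective (cong index eq)
  fork-index (y , y′ , inj₂ (eq , refl , refl)) = cong sucₘ (cong index eq)

  module _ {G : Group c ℓ} (A : AutAction G Γ) where
    open Group G using (_≈_; _∙_; ε; _⁻¹) renaming (Carrier to X)
    open AutAction A
    open AutActionProperties A
    open ActionProperties vertexAction

    FibrePreserving : Set c
    FibrePreserving = ∀ g {u u′} → index u ≡ index u′ → index (actV g u) ≡ index (actV g u′)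

    -- Ends of a fork share their index, so `g ⁻¹` would put the ends of a directed path of length
    -- two into one fibre, although their indices differ by 2, which is nonzero modulo r ≥ 3.
    fibrePreserving⇒unfolded : FibrePreserving → Unfolded
    fibrePreserving⇒unfolded fp g {e} {e′} eq fork = sucₘsucₘ≢ 3≤r (trans (sym (step-index {e} {e′} eq))
      (sym (≡.subst₂ (λ u u′ → index u ≡ index u′) (act-⁻¹ˡ g _) (act-⁻¹ˡ g _) (fp (g ⁻¹) (fork-index fork)))))

    unfolded⇒semidirect : ArcRegular → Unfolded →
      Prime p → ¬ (2 ∣ p) → ¬ (p ∣ suc m) → Σ (DihAction p (suc s) (suc m)) (λ θ → IsoToSD G θ)
    unfolded⇒semidirect regular unfolded = DirectedActionProperties.semidirect 3≤r record
      { action     = edgeAction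
      ; reverses   = reverses
      ; preserve   = λ g dir {e} {e′} (i , x) → followed {actE g e} {actE g e′} (trans (proj₂ (forward g dir e))
                       (trans (cong (actV g) (cong₂ _,_ i x)) (sym (proj₁ (forward g dir e′)))))
      ; reverse    = λ g dir {e} {e′} (i , x) → followed {actE g e′} {actE g e} (trans (proj₂ (backward g dir e′))
                       (trans (cong (actV g) (sym (cong₂ _,_ i x))) (sym (proj₁ (backward g dir e)))))
      ; transitive = oriented-transitive
      ; free       = oriented-free
      }
      where
      followed : ∀ {e e′ : Edge p (suc m) s} → end₂ Γ e ≡ end₁ Γ e′ → Follow e e′
      followed eq = cong proj₁ eq , cong proj₂ eq
      open Orientation regular (λ e eq → sucₘ≢ 3≤r (sym (cong index eq))) unfolded
        (λ P fwd bwd → Connected.connected (suc q) m s P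
           (λ (i , x) → fwd (cong₂ _,_ i x)) (λ (i , x) → bwd (cong₂ _,_ i x)))
        (zero , replicate (suc s) zero)

module PX₁Adjacency (p m : ℕ) where

  private
    Γ : Multigraph
    Γ = PX p (suc m) 1

  Next : Fin (suc m) → Fin (suc m) → Set
  Next i k = sucₘ i ≡ k ⊎ sucₘ k ≡ i

  adj⇒next : ∀ {v w} → Adj Γ v w → Next (proj₁ v) (proj₁ w)
  adj⇒next (e , inj₁ (refl , refl)) = inj₁ refl
  adj⇒next (e , inj₂ (refl , refl)) = inj₂ refl

  next⇒adj : ∀ {v w} → Next (proj₁ v) (proj₁ w) → Adj Γ v w
  next⇒adj {i , x ∷ []} {k , y ∷ []} (inj₁ refl) = (i , x ∷ y ∷ []) , inj₁ (refl , refl)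
  next⇒adj {i , x ∷ []} {k , y ∷ []} (inj₂ refl) = (k , y ∷ x ∷ []) , inj₂ (refl , refl)

module _ (q m : ℕ) (3≤r : 3 ≤ suc m) {G : Group c ℓ} where
  open Modular m

  PX₀-fibrePreserving : ∀ A → PXGraph.FibrePreserving q m 0 3≤r {G = G} A
  PX₀-fibrePreserving A g {i , []} {_ , []} refl = refl

  -- For s = 1 adjacency depends on indices only, so `u` and `u′` have the same neighbours, and so
  -- have their images, of indices `j` and `j′`. Hence `j′` is next to both `j + 1` and `j - 1`.
  PX₁-fibrePreserving : suc m ≢ 4 → ∀ A → PXGraph.FibrePreserving q m 1 3≤r {G = G} A
  PX₁-fibrePreserving r≢4 A g {u} {u′} eq = compare (neighbour (inj₁ refl)) (neighbour (inj₂ pred-j))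
    where
    open Group G using (_⁻¹)
    open AutAction A
    open AutActionProperties A
    open ActionProperties vertexAction
    open PX₁Adjacency (suc (suc q)) m
    Γ = PX (suc (suc q)) (suc m) 1
    j = proj₁ (actV g u)
    j′ = proj₁ (actV g u′)
    j⁻ = proj₁ (predₘ j)
    pred-j : sucₘ j⁻ ≡ j
    pred-j = proj₂ (predₘ j)

    neighbour : ∀ {k} → Next j k → Next j′ k
    neighbour {k} next = adj⇒next (subst (Adj Γ (actV g u′)) (act-⁻¹ʳ g w) (adj-act g
      (next⇒adj {u′} {actV (g ⁻¹) w} (subst (λ i → Next i (proj₁ (actV (g ⁻¹) w))) eq (adj⇒next (adj-⁻¹ g (next⇒adj {w = w} next)))))))
      where
      w : V Γ
      w = k , zero ∷ []

    compare : Next j′ (sucₘ j) → Next j′ j⁻ → j ≡ j′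
    compare (inj₁ e) _        = sym (sucₘ-injective e)
    compare (inj₂ _) (inj₂ e) = trans (sym pred-j) e
    -- Here `j′` is both j + 2 and j - 2, so r divides 4, which leaves only the excluded r = 4.
    compare (inj₂ e) (inj₁ e′) = contradiction
      (sucₘ^-fixed 4 {j} (trans (cong (sucₘ ∘ sucₘ) e) (trans (cong sucₘ e′) pred-j))) (r∤4 3≤r r≢4)
      where
      r∤4 : ∀ {r} → 3 ≤ r → r ≢ 4 → ¬ (r ∣ 4)
      r∤4 {r} 3≤r r≢4 r∣4 with ℕₚ.m≤n⇒m<n∨m≡n (∣⇒≤ r∣4)
      ... | inj₂ r≡4 = r≢4 r≡4
      ... | inj₁ r<4 with ℕₚ.≤-antisym (s≤s⁻¹ r<4) 3≤r
      ...   | refl = from-no (3 ∣? 4) r∣4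

module PX≥2 (q m t : ℕ) (3≤r : 3 ≤ suc m) where
  open Modular m
  open PXGraph (suc q) m (suc (suc t)) 3≤r

  private
    p : ℕ
    p = suc (suc (suc q))

    Γ : Multigraph
    Γ = PX p (suc m) (suc (suc t))

    Out : V Γ → V Γ → Set
    Out (i , u) (k , w) = sucₘ i ≡ k × tail u ≡ init w

    adj⇒out : ∀ {u w} → Adj Γ u w → Out u w ⊎ Out w u
    adj⇒out ((i , a ∷ x) , inj₁ (refl , refl)) = inj₁ (refl , refl)
    adj⇒out ((i , a ∷ x) , inj₂ (refl , refl)) = inj₂ (refl , refl)

    out⇒edge : ∀ {u w} → Out u w → ∃ λ e → end₁ Γ e ≡ u × end₂ Γ e ≡ w
    out⇒edge {i , a ∷ u} {k , w} (refl , eq) = (i , a ∷ w) , cong (λ v → i , a ∷ v) (sym eq) , refl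

    out⇒adj : ∀ {u w} → Out u w → Adj Γ u w
    out⇒adj out = let e , ends = out⇒edge out in e , inj₁ ends

    out⇒adj′ : ∀ {u w} → Out w u → Adj Γ u w
    out⇒adj′ out = let e , ends = out⇒edge out in e , inj₂ ends

    CommonNeighbours : V Γ → V Γ → Set
    CommonNeighbours u w = ∃ λ (n : Fin p → V Γ) →
      (∀ {a b} → n a ≡ n b → a ≡ b) × (∀ a → Adj Γ u (n a) × Adj Γ w (n a))

    -- Tails of edges with a common head have p common out-neighbours, which vary in the last entry;
    -- heads of edges with a common tail have p common in-neighbours, which vary in the first.
    fork⇒commonNeighbours : ∀ {u u′} → Fork Γ u u′ → CommonNeighbours u u′
    fork⇒commonNeighbours ((j , a ∷ x) , (j′ , a′ ∷ x′) , inj₁ (eq , refl , refl)) =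
      (λ b → sucₘ j , init x ∷ʳ b) , (λ e → ∷ʳ-injectiveʳ _ _ (cong proj₂ e)) ,
      λ b → out⇒adj {u = j , init (a ∷ x)} (refl , sym (init-∷ʳ b (init x))) ,
            out⇒adj {u = j′ , init (a′ ∷ x′)} (cong proj₁ (sym eq) ,
              trans (cong init (cong proj₂ (sym eq))) (sym (init-∷ʳ b (init x))))
    fork⇒commonNeighbours ((j , a ∷ x) , (j′ , a′ ∷ x′) , inj₂ (eq , refl , refl)) =
      (λ b → j , b ∷ init x) , (λ { refl → refl }) ,
      λ b → out⇒adj′ {u = sucₘ j , x} {w = j , b ∷ init x} (refl , refl) ,
            out⇒adj′ {u = sucₘ j′ , x′} {w = j , b ∷ init x}
              (cong sucₘ (cong proj₁ eq) , cong tail (cong proj₂ eq))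

    -- The two ways to be adjacent to both `u` and a `w` two steps ahead: in the middle of the path,
    -- or, when r = 4, on the opposite way round the cycle.
    Between Around : V Γ → V Γ → V Γ → Set
    Between u w n = Out u n × Out n w
    Around u w n = Out n u × Out w n

    -- The tail of the tuple of `n` is read off from `w` and its head from `u`; reading the head
    -- takes tuples of length at least two.
    between-unique : ∀ {u w n n′} → Between u w n → Between u w n′ → n ≡ n′
    between-unique {n = k , a ∷ b ∷ n} {k′ , a′ ∷ b′ ∷ n′} ((k≡ , i) , _ , o) ((k′≡ , i′) , _ , o′) =
      cong₂ _,_ (trans (sym k≡) k′≡) (cong₂ _∷_ (cong head (trans (sym i) i′)) (trans o (sym o′)))

    around-unique : ∀ {u w n n′} → Around u w n → Around u w n′ → n ≡ n′
    around-unique {n = k , a ∷ b ∷ n} {k′ , a′ ∷ b′ ∷ n′} ((_ , o) , k≡ , i) ((_ , o′) , k′≡ , i′) =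
      cong₂ _,_ (trans (sym k≡) k′≡) (cong₂ _∷_ (cong head (trans (sym i) i′)) (trans o (sym o′)))

    classify : ∀ {u w n} → proj₁ w ≡ sucₘ (sucₘ (proj₁ u)) → Adj Γ u n → Adj Γ w n →
               Between u w n ⊎ Around u w n
    classify {u} {w} {n} eq un wn with adj⇒out {u} {n} un | adj⇒out {w} {n} wn
    ... | inj₁ o | inj₂ o′ = inj₁ (o , o′)
    ... | inj₂ o | inj₁ o′ = inj₂ (o , o′)
    ... | inj₁ (i , _) | inj₁ (i′ , _) = contradiction (trans (sym eq) (sucₘ-injective (trans i′ (sym i)))) (sucₘsucₘ≢ 3≤r)
    ... | inj₂ (i , _) | inj₂ (i′ , _) = contradiction (trans (sym eq) (trans (sym i′) i)) (sucₘsucₘ≢ 3≤r)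

    -- There is at most one neighbour of each of the two kinds, so three of the p ≥ 3 common
    -- neighbours cannot be distinct.
    ¬commonNeighbours : ∀ {u w} → proj₁ w ≡ sucₘ (sucₘ (proj₁ u)) → ¬ CommonNeighbours u w
    ¬commonNeighbours {u} {w} eq (n , injective , adjacent) = two (pigeonhole (ℕₚ.n<1+n 2) (side ∘ kind))
      where
      3≤p : 3 ≤ p
      3≤p = s≤s (s≤s (s≤s z≤n))

      label : Fin 3 → Fin p
      label a = inject≤ a 3≤p

      kind : ∀ a → Between u w (n (label a)) ⊎ Around u w (n (label a))
      kind a = let un , wn = adjacent (label a) in classify {u} {w} eq un wn

      side : ∀ {P Q : Set} → P ⊎ Q → Fin 2
      side (inj₁ _) = zero
      side (inj₂ _) = suc zero

      same : ∀ a b → side (kind a) ≡ side (kind b) → n (label a) ≡ n (label b)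
      same a b e with kind a | kind b
      ... | inj₁ x | inj₁ y = between-unique {u} {w} x y
      ... | inj₂ x | inj₂ y = around-unique {u} {w} x y

      two : (∃₂ λ a b → toℕ a < toℕ b × side (kind a) ≡ side (kind b)) → ⊥
      two (a , b , a<b , e) = ℕₚ.<-irrefl (cong toℕ (inject≤-injective 3≤p 3≤p a b (injective (same a b e)))) a<b

  module _ {G : Group c ℓ} (A : AutAction G Γ) where
    open Group G using (_⁻¹)
    open AutAction A
    open AutActionProperties A
    open ActionProperties vertexAction

    PX≥2-unfolded : Unfolded
    PX≥2-unfolded g {e} {e′} eq fork =
      let n , injective , adjacent = fork⇒commonNeighbours fork in
      ¬commonNeighbours {end₁ Γ e} {end₂ Γ e′} (step-index {e} {e′} eq) (actV (g ⁻¹) ∘ n ,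
        injective ∘ act-injective (g ⁻¹) ,
        λ a → adj-⁻¹ g (proj₁ (adjacent a)) , adj-⁻¹ g (proj₂ (adjacent a)))

-- Block systems on K_{2p,2p}

-- Arc-regularity of K_{n,n} without edges: an arc is an ordered pair of vertices on different
-- sides.
record CompleteBipartiteAction {c ℓ} (G : Group c ℓ) (V : Set) (n : ℕ) : Set (c Level.⊔ ℓ) where
  open Group G using (_≈_; ε; _∙_) renaming (Carrier to X)
  field
    action : Action G V
    _≟_    : DecidableEquality V
    side   : V → Bool
    base   : Bool → V
    side-base : ∀ b → side (base b) ≡ b
    part   : Bool → List V
    part-unique : ∀ b → Unique (part b)
    part-length : ∀ b → length (part b) ≡ n
    ∈-part⁺ : ∀ {v b} → side v ≡ b → v ∈ part b
    ∈-part⁻ : ∀ {v b} → v ∈ part b → side v ≡ b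
  open Action action public
  field
    side-act   : ∀ g {u v} → side u ≡ side v → side (act g u) ≡ side (act g v)
    transitive : ∀ {u w u′ w′} → side u ≢ side w → side u′ ≢ side w′ → ∃ λ g → act g u ≡ u′ × act g w ≡ w′
    free       : ∀ g {u w} → side u ≢ side w → act g u ≡ u → act g w ≡ w → g ≈ ε

record BlockSystem {c ℓ} {G : Group c ℓ} {V : Set} {n : ℕ} (B : CompleteBipartiteAction G V n) (p : ℕ) : Set c where
  open CompleteBipartiteAction B
  field
    block        : V → List V
    block-length : ∀ v → length (block v) ≡ p
    block-unique : ∀ v → Unique (block v)
    block-refl   : ∀ v → v ∈ block v
    block-sym    : ∀ {u v} → u ∈ block v → v ∈ block u
    block-trans  : ∀ {u v w} → v ∈ block u → w ∈ block v → w ∈ block u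
    block-act    : ∀ g {u v} → u ∈ block v → act g u ∈ block (act g v)
    block-side   : ∀ {u v} → u ∈ block v → side u ≡ side v

module BlocksExist {G : Group c ℓ} {V : Set} {q : ℕ} (p-prime : Prime (suc (suc q))) (2∤p : ¬ (2 ∣ suc (suc q)))
  (B : CompleteBipartiteAction G V (2 * suc (suc q))) where
  open Group G renaming (Carrier to X; refl to ≈-refl; sym to ≈-sym; trans to ≈-trans)
  open Powers G
  open CompleteBipartiteAction B
  open ActionProperties action
  open Finite _≟_

  private
    p : ℕ
    p = suc (suc q)

  opp : V → V
  opp v = base (not (side v))

  opp-side : ∀ v → side v ≢ side (opp v)
  opp-side v eq = not-¬ (sym (trans eq (side-base _))) refl

  opposite : ∀ {u v w} → side u ≢ side w → side v ≢ side w → side u ≡ side v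
  opposite uw vw = trans (¬-not uw) (sym (¬-not vw))

  act-opposite : ∀ g {u w} → side u ≢ side w → side (act g u) ≢ side (act g w)
  act-opposite g {u} {w} uw eq = uw (≡.subst₂ (λ x y → side x ≡ side y) (act-⁻¹ˡ g u) (act-⁻¹ˡ g w) (side-act (g ⁻¹) eq))

  ≈-ext : ∀ {g h u w} → side u ≢ side w → act g u ≡ act h u → act g w ≡ act h w → g ≈ h
  ≈-ext {g} {h} uw eqᵤ eq = ∙-cancelˡ (h ⁻¹) g h (≈-trans (free _ uw (fix eqᵤ) (fix eq)) (≈-sym (inverseˡ h)))
    where
    fix : ∀ {x} → act g x ≡ act h x → act (h ⁻¹ ∙ g) x ≡ x
    fix {x} eq = trans (act-∙ _ _ _) (trans (cong (act (h ⁻¹)) eq) (act-⁻¹ˡ h x))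

  farPart : V → List V
  farPart v = part (side (opp v))

  ∈-farPart⁺ : ∀ {v w} → side v ≢ side w → w ∈ farPart v
  ∈-farPart⁺ {v} vw = ∈-part⁺ (opposite (vw ∘ sym) (opp-side v ∘ sym))

  ∈-farPart⁻ : ∀ {v w} → w ∈ farPart v → side v ≢ side w
  ∈-farPart⁻ {v} w∈ eq = opp-side v (trans eq (∈-part⁻ w∈))

  farPart-closed : ∀ {g v} → act g v ≡ v → ∀ {w} → w ∈ farPart v → act g w ∈ farPart v
  farPart-closed {g} {v} gv w∈ = ∈-farPart⁺ (subst (λ x → side x ≢ _) gv (act-opposite g (∈-farPart⁻ w∈)))

  -- The stabilizer of `v` acts freely on the 2p opposite vertices, so `pow-length` applies to that
  -- part.
  stabilizer-order : ∀ {g v} → act g v ≡ v → (2 * p) ⋆ g ≈ ε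
  stabilizer-order {g} {v} gv = ≈-trans (⋆-congˡ (sym (part-length _)))
    (pow-length _≟_ g (farPart v) (part-unique _) (∈-farPart⁺ (opp-side v)) (farPart-closed gv)
      (λ {x} x∈ n eq → free (n ⋆ g) (∈-farPart⁻ x∈) (fix-⋆ n g gv) eq))

  module KleinFour {v} {g₁ g₂ : X} (g₁v : act g₁ v ≡ v) (g₂v : act g₂ v ≡ v)
                   (involutive : ∀ {g} → act g v ≡ v → g ∙ g ≈ ε)
                   (g₁≉ε : ¬ (g₁ ≈ ε)) (g₂≉ε : ¬ (g₂ ≈ ε)) (g₁≉g₂ : ¬ (g₁ ≈ g₂)) where

    private
      I : Set
      I = Bool × Bool

      _⊕_ : I → I → I
      (a , b) ⊕ (a′ , b′) = (a xor a′ , b xor b′)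

      k : I → X
      k (false , false) = ε
      k (true  , false) = g₁
      k (false , true)  = g₂
      k (true  , true)  = g₁ ∙ g₂

      fix-∙ : ∀ {g h u} → act g u ≡ u → act h u ≡ u → act (g ∙ h) u ≡ u
      fix-∙ {g} gu hu = trans (act-∙ _ _ _) (trans (cong (act g) hu) gu)

      kv : ∀ i → act (k i) v ≡ v
      kv (false , false) = act-ε v
      kv (true  , false) = g₁v
      kv (false , true)  = g₂v
      kv (true  , true)  = fix-∙ g₁v g₂v

      self-inverse : ∀ {g} → act g v ≡ v → g ≈ g ⁻¹
      self-inverse gv = inverseˡ-unique _ _ (involutive gv)

      commute : ∀ {g h} → act g v ≡ v → act h v ≡ v → g ∙ h ≈ h ∙ g
      commute {g} {h} gv hv = ≈-trans (self-inverse (fix-∙ gv hv)) (≈-trans (⁻¹-anti-homo-∙ g h)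
        (∙-cong (≈-sym (self-inverse hv)) (≈-sym (self-inverse gv))))

      cancelˡ : ∀ {g h} → act g v ≡ v → g ∙ (g ∙ h) ≈ h
      cancelˡ {g} {h} gv = ≈-trans (≈-sym (assoc g g h)) (≈-trans (∙-congʳ (involutive gv)) (identityˡ h))

      k-⊕₁ : ∀ i → k ((true , false) ⊕ i) ≈ g₁ ∙ k i
      k-⊕₁ (false , false) = ≈-sym (identityʳ g₁)
      k-⊕₁ (true  , false) = ≈-sym (involutive g₁v)
      k-⊕₁ (false , true)  = ≈-refl
      k-⊕₁ (true  , true)  = ≈-sym (cancelˡ g₁v)

      k-⊕₂ : ∀ i → k ((false , true) ⊕ i) ≈ g₂ ∙ k i
      k-⊕₂ (false , false) = ≈-sym (identityʳ g₂)
      k-⊕₂ (true  , false) = commute g₁v g₂v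
      k-⊕₂ (false , true)  = ≈-sym (involutive g₂v)
      k-⊕₂ (true  , true)  = ≈-sym (≈-trans (∙-congˡ (commute g₁v g₂v)) (cancelˡ g₂v))

      k-homo : ∀ i j → k (i ⊕ j) ≈ k i ∙ k j
      k-homo (false , false) j = ≈-sym (identityˡ (k j))
      k-homo (true  , false) j = k-⊕₁ j
      k-homo (false , true)  j = k-⊕₂ j
      k-homo (true  , true)  j = ≈-trans (k-⊕₁ ((false , true) ⊕ j)) (≈-trans (∙-congˡ (k-⊕₂ j)) (≈-sym (assoc _ _ _)))

      k-injective : ∀ i j → k i ≈ k j → i ≡ j
      k-injective i j eq = diff i j (trivial (i ⊕ j) (≈-trans (k-homo i j) (≈-trans (∙-congʳ eq) (involutive (kv j)))))
        where
        trivial : ∀ i → k i ≈ ε → i ≡ (false , false)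
        trivial (false , false) _  = refl
        trivial (true  , false) eq = contradiction eq g₁≉ε
        trivial (false , true)  eq = contradiction eq g₂≉ε
        trivial (true  , true)  eq = contradiction (≈-trans (inverseˡ-unique g₁ g₂ eq) (≈-sym (self-inverse g₂v))) g₁≉g₂
        xor≡false : ∀ a b → a xor b ≡ false → a ≡ b
        xor≡false false false _ = refl
        xor≡false true  true  _ = refl
        diff : ∀ i j → i ⊕ j ≡ (false , false) → i ≡ j
        diff (a , b) (a′ , b′) eq = cong₂ _,_ (xor≡false a a′ (cong proj₁ eq)) (xor≡false b b′ (cong proj₂ eq))

      allI : List I
      allI = (false , false) ∷ (true , false) ∷ (false , true) ∷ (true , true) ∷ []

      ∈-allI : ∀ i → i ∈ allI
      ∈-allI (false , false) = here refl
      ∈-allI (true  , false) = there (here refl)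
      ∈-allI (false , true)  = there (there (here refl))
      ∈-allI (true  , true)  = there (there (there (here refl)))

      allI-unique : Unique allI
      allI-unique = ((λ ()) ∷ (λ ()) ∷ (λ ()) ∷ []) ∷ ((λ ()) ∷ (λ ()) ∷ []) ∷ ((λ ()) ∷ []) ∷ [] ∷ []

      O : V → List V
      O u = map (λ i → act (k i) u) allI

      ∈-O : ∀ i {u} → act (k i) u ∈ O u
      ∈-O i {u} = ∈-map⁺ (λ i → act (k i) u) (∈-allI i)

      ∈-O⁻ : ∀ {u w} → w ∈ O u → ∃ λ i → w ≡ act (k i) u
      ∈-O⁻ {u} w∈ with ∈-map⁻ (λ i → act (k i) u) {xs = allI} w∈
      ... | i , _ , eq = i , eq

      O-sym : ∀ {u w} → w ∈ O u → u ∈ O w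
      O-sym {u} w∈ with ∈-O⁻ w∈
      ... | i , refl = subst (_∈ O (act (k i) u))
              (trans (sym (act-∙ _ _ _)) (trans (act-cong (involutive (kv i)) u) (act-ε u))) (∈-O i)

      O-trans : ∀ {u w z} → w ∈ O u → z ∈ O w → z ∈ O u
      O-trans {u} w∈ z∈ with ∈-O⁻ w∈ | ∈-O⁻ z∈
      ... | i , refl | j , refl = subst (_∈ O u) (trans (act-cong (k-homo j i) u) (act-∙ _ _ u)) (∈-O (j ⊕ i))

    -- The four elements `k i` are distinct and act freely on the opposite part, so they split its
    -- 2p vertices into orbits of size four.
    4∣2p : 4 ∣ 2 * p
    4∣2p = subst (4 ∣_) (part-length _) (class-size-divides 4 O (λ _ → refl)
      (λ u → subst (_∈ O u) (act-ε u) (∈-O (false , false))) O-sym O-trans (farPart v) (part-unique _)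
      (λ {u} u∈ → map⁺ (λ {i} {j} eq → k-injective i j (≈-ext (∈-farPart⁻ u∈) (trans (kv i) (sym (kv j))) eq)) allI-unique)
      (λ {u} u∈ w∈ → closed u∈ w∈))
      where
      closed : ∀ {u w} → u ∈ farPart v → w ∈ O u → w ∈ farPart v
      closed u∈ w∈ with ∈-O⁻ w∈
      ... | i , refl = farPart-closed (kv i) u∈

  private
    move : ∀ v {x} → side v ≢ side x → ∃ λ g → act g v ≡ v × act g (opp v) ≡ x
    move v vx = transitive (opp-side v) vx

    -- As 2p ≥ 4, there are two further vertices `x₁`, `x₂` opposite to `v`. Stabilizer elements
    -- carrying `w` to them are nontrivial and distinct, so they would generate a four-group.
    ¬allInvolutive : ∀ v → ¬ (∀ {g} → act g v ≡ v → g ∙ g ≈ ε)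
    ¬allInvolutive v involutive = 2∤p (*-cancelˡ-∣ 2 4∣2p)
      where
      w = opp v
      long : ∀ {l} → l < 4 → l < length (farPart v)
      long l<4 = subst (_ <_) (sym (part-length _)) (ℕₚ.<-≤-trans l<4 (ℕₚ.*-monoʳ-≤ 2 (s≤s (s≤s z≤n))))
      first = ∃-outside {xs = w ∷ []} (part-unique (side w)) (long (s≤s (s≤s z≤n)))
      x₁ = proj₁ first
      second = ∃-outside {xs = w ∷ x₁ ∷ []} (part-unique (side w)) (long (s≤s (s≤s (s≤s z≤n))))
      x₂ = proj₁ second
      m₁ = move v (∈-farPart⁻ (proj₁ (proj₂ first)))
      m₂ = move v (∈-farPart⁻ (proj₁ (proj₂ second)))
      act-w : ∀ {g h x y} → act g w ≡ x → act h w ≡ y → g ≈ h → y ≡ x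
      act-w gw hw g≈h = trans (sym hw) (trans (sym (act-cong g≈h w)) gw)
      open KleinFour {v} (proj₁ (proj₂ m₁)) (proj₁ (proj₂ m₂)) involutive
        (λ eq → proj₂ (proj₂ first) (here (sym (act-w (proj₂ (proj₂ m₁)) (act-ε w) eq))))
        (λ eq → proj₂ (proj₂ second) (here (sym (act-w (proj₂ (proj₂ m₂)) (act-ε w) eq))))
        (λ eq → proj₂ (proj₂ second) (there (here (act-w (proj₂ (proj₂ m₁)) (proj₂ (proj₂ m₂)) eq))))

  record Generator (v : V) (g : X) : Set ℓ where
    constructor generator
    field
      fixes      : act g v ≡ v
      order      : p ⋆ g ≈ ε
      nontrivial : ¬ (g ≈ ε)

  private
    -- With `x` running over the opposite part this enumerates the stabilizer of `v`. The value `ε`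
    -- on the near side is a default that makes the function total.
    mover : V → V → X
    mover v x with Boolₚ._≟_ (side v) (side x)
    ... | yes _ = ε
    ... | no vx = proj₁ (move v vx)

    mover-fixes : ∀ v x → act (mover v x) v ≡ v
    mover-fixes v x with Boolₚ._≟_ (side v) (side x)
    ... | yes _ = act-ε v
    ... | no vx = proj₁ (proj₂ (move v vx))

    mover-moves : ∀ v x → side v ≢ side x → act (mover v x) (opp v) ≡ x
    mover-moves v x v≢x with Boolₚ._≟_ (side v) (side x)
    ... | yes v≡x = contradiction v≡x v≢x
    ... | no vx   = proj₂ (proj₂ (move v vx))

  -- Every stabilizer element equals a `mover`, so whether some square is nontrivial is decided by
  -- finitely many vertex comparisons. A nontrivial square has order p, because the stabilizer has
  -- exponent dividing 2p.
  generator-exists : ∀ v → ∃ (Generator v)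
  generator-exists v with Any.any? (λ x → ¬? (act (2 ⋆ mover v x) (opp v) ≟ opp v)) (farPart v)
  ... | yes some = let x , _ , moved = find some ; g = mover v x in
        2 ⋆ g , generator (fix-⋆ 2 g (mover-fixes v x))
          (≈-trans (⋆-assoc g p 2) (≈-trans (⋆-congˡ (ℕₚ.*-comm p 2)) (stabilizer-order (mover-fixes v x))))
          (λ eq → moved (trans (act-cong eq (opp v)) (act-ε (opp v))))
  ... | no none = ⊥-elim (¬allInvolutive v involutive)
    where
    involutive : ∀ {g} → act g v ≡ v → g ∙ g ≈ ε
    involutive {g} gv = ≈-trans (∙-cong g≈m (≈-trans g≈m (≈-sym (identityʳ m))))
      (free (2 ⋆ m) (opp-side v) (fix-⋆ 2 m (mover-fixes v x))
        (decidable-stable (_ ≟ _) (λ ≢ → none (lose (farPart-closed gv (∈-farPart⁺ (opp-side v))) ≢))))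
      where
      x = act g (opp v)
      m = mover v x
      vx : side v ≢ side x
      vx = ∈-farPart⁻ (farPart-closed gv (∈-farPart⁺ (opp-side v)))
      g≈m : g ≈ m
      g≈m = ≈-ext (opp-side v) (trans gv (sym (mover-fixes v x))) (sym (mover-moves v x vx))

  generator-free : ∀ {v a} → Generator v a → ∀ {x} → side v ≢ side x → ∀ i → 0 < i → i < p → act (i ⋆ a) x ≢ x
  generator-free {a = a} gen {x} vx i 0<i i<p eq = nontrivial (free a vx fixes
    (fix-coprime a (<prime⇒coprime p-prime 0<i i<p) 0<i eq (trans (act-cong order x) (act-ε x))))
    where open Generator gen

  -- The opposite part is the union of two orbits of `a`, those of `w` and of `act b w`, when
  -- `act b w` lies outside the first. Then `b` maps `act b w` either within its orbit, so freeness
  -- makes `b` a power of `a`, or back to the orbit of `w`, so `b ∙ b` is one. Hence the stabilizer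
  -- has only one subgroup of order p.
  generates : ∀ {v a b} → Generator v a → act b v ≡ v → p ⋆ b ≈ ε → ∃ λ k → b ≈ k ⋆ a
  generates {v} {a} {b} gen bv bᵖ = decide (act b w ∈? O₁)
    where
    open Generator gen
    open Cyclic a p order
    w = opp v
    O₁ = orbit a p w
    O₂ = orbit a p (act b w)

    power : ∀ {h x z} → act h v ≡ v → side v ≢ side x → act h x ≡ z → z ∈ orbit a p x → ∃ λ k → h ≈ k ⋆ a
    power {h} {x} hv vx refl z∈ with ∈-applyUpTo⁻ (λ i → act (i ⋆ a) x) z∈
    ... | k , _ , eq = k , ≈-ext vx (trans hv (sym (fix-⋆ k a fixes))) eq

    v-bw : side v ≢ side (act b w)
    v-bw = ∈-farPart⁻ (farPart-closed bv (∈-farPart⁺ (opp-side v)))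

    -- b = b¹⁺ᵖ is a power of b² because p is odd.
    root : (∃ λ k → b ∙ b ≈ k ⋆ a) → ∃ λ k → b ≈ k ⋆ a
    root (k , eq) = suc h * k , ≈-trans (≈-sym (≈-trans (∙-congˡ bᵖ) (identityʳ b)))
      (≈-trans (⋆-congˡ (cong suc (proj₂ (odd p 2∤p)))) (≈-trans (≈-sym (⋆-assoc b (suc h) 2))
      (≈-trans (⋆-congʳ (suc h) (≈-trans (∙-congˡ (identityʳ b)) eq)) (⋆-assoc a (suc h) k))))
      where
      h = proj₁ (odd p 2∤p)

    decide : Dec (act b w ∈ O₁) → ∃ λ k → b ≈ k ⋆ a
    decide (yes bw∈) = power bv (opp-side v) refl bw∈
    decide (no bw∉) = [ (λ z∈ → root (power bbv (opp-side v) (act-∙ b b w) z∈))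
                      , (λ z∈ → power bv v-bw refl z∈) ]′ (∈-++⁻ O₁ (covers (farPart-closed bv (∈-farPart⁺ v-bw))))
      where
      bbv : act (b ∙ b) v ≡ v
      bbv = trans (act-∙ b b v) (trans (cong (act b) bv) bv)
      unique : Unique (O₁ ++ O₂)
      unique = ++⁺ (orbit-unique a p (generator-free gen (opp-side v))) (orbit-unique a p (generator-free gen v-bw))
        (λ (z∈₁ , z∈₂) → bw∉ (orbit-trans z∈₁ (orbit-sym z∈₂)))
      O⊆ : O₁ ++ O₂ ⊆ farPart v
      O⊆ z∈ = [ orbit-⊆ a p (farPart-closed fixes) (∈-farPart⁺ (opp-side v))
              , orbit-⊆ a p (farPart-closed fixes) (∈-farPart⁺ v-bw) ]′ (∈-++⁻ O₁ z∈)
      covers : farPart v ⊆ O₁ ++ O₂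
      covers = Unique⊆∧length≥⇒⊇ unique O⊆ (ℕₚ.≤-reflexive (trans (part-length _)
        (sym (trans (length-++ O₁) (cong₂ _+_ (orbit-length a p w) (trans (orbit-length a p (act b w)) (sym (ℕₚ.+-identityʳ p))))))))

  conj : X → X → X
  conj g x = g ∙ x ∙ g ⁻¹

  act-conj : ∀ g x v → act (conj g x) (act g v) ≡ act g (act x v)
  act-conj g x v = trans (act-∙ _ _ _) (trans (act-∙ _ _ _) (cong (act g ∘ act x) (act-⁻¹ˡ g v)))

  conj-⋆ : ∀ n g x → n ⋆ conj g x ≈ conj g (n ⋆ x)
  conj-⋆ zero    g x = ≈-sym (≈-trans (∙-congʳ (identityʳ g)) (inverseʳ g))
  conj-⋆ (suc n) g x = ≈-trans (∙-congˡ (conj-⋆ n g x)) (≈-trans (≈-sym (assoc _ _ _)) (∙-congʳ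
    (≈-trans (assoc _ _ _) (≈-trans (∙-congˡ (≈-trans (≈-sym (assoc _ _ _)) (≈-trans (∙-congʳ (inverseˡ g)) (identityˡ _))))
      (assoc _ _ _)))))

  conj-generator : ∀ g {v a} → Generator v a → Generator (act g v) (conj g a)
  conj-generator g {v} {a} gen = generator
    (trans (act-conj g a v) (cong (act g) fixes))
    (≈-trans (conj-⋆ p g a) (≈-trans (∙-congʳ (≈-trans (∙-congˡ order) (identityʳ g))) (inverseʳ g)))
    (λ eq → nontrivial (∙-cancelˡ g a ε (∙-cancelʳ (g ⁻¹) (g ∙ a) (g ∙ ε)
      (≈-trans eq (≈-sym (≈-trans (∙-congʳ (identityʳ g)) (inverseʳ g)))))))
    where open Generator gen

  gen : V → X
  gen v = proj₁ (generator-exists v)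

  isGen : ∀ v → Generator v (gen v)
  isGen v = proj₂ (generator-exists v)

  move-generator : ∀ {u v a} → Generator v a → act a u ≡ u → Generator u a
  move-generator (generator _ order nontrivial) au = generator au order nontrivial

  -- Generators at one vertex are powers of each other. This makes "`gen v` fixes `u`" an invariant
  -- equivalence: if it holds, `gen v` is a generator at `u` as well, and conjugates of generators
  -- are generators.
  same-fixed : ∀ {v a b u} → Generator v a → Generator v b → act a u ≡ u → act b u ≡ u
  same-fixed {a = a} ga gb au with generates ga (Generator.fixes gb) (Generator.order gb)
  ... | k , eq = trans (act-cong eq _) (fix-⋆ k a au)

  fixed-sym : ∀ {u v} → act (gen v) u ≡ u → act (gen u) v ≡ v
  fixed-sym {u} {v} eq = same-fixed (move-generator (isGen v) eq) (isGen u) (Generator.fixes (isGen v))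

  fixed-trans : ∀ {u v w} → act (gen u) v ≡ v → act (gen v) w ≡ w → act (gen u) w ≡ w
  fixed-trans {u} {v} eq eq′ = same-fixed (isGen v) (move-generator (isGen u) eq) eq′

  fixed-act : ∀ g {u v} → act (gen v) u ≡ u → act (gen (act g v)) (act g u) ≡ act g u
  fixed-act g {u} {v} eq = same-fixed (conj-generator g (isGen v)) (isGen (act g v))
    (trans (act-conj g (gen v) u) (cong (act g) eq))

  fixed-side : ∀ {u v} → act (gen v) u ≡ u → side u ≡ side v
  fixed-side {u} {v} eq with Boolₚ._≟_ (side u) (side v)
  ... | yes same = same
  ... | no uv = contradiction (free (gen v) (uv ∘ sym) (Generator.fixes (isGen v)) eq) (Generator.nontrivial (isGen v))

  private
    fixed? : ∀ v u → Dec (act (gen v) u ≡ u)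
    fixed? v u = act (gen v) u ≟ u

    nearPart : V → List V
    nearPart v = part (side v)

  fixed : V → List V
  fixed v = filter (fixed? v) (nearPart v)

  FixesPart : V → Set
  FixesPart v = ∀ u → side u ≡ side v → act (gen v) u ≡ u

  -- The nontrivial orbits of the generator all have p points.
  fixed-count : ∀ v → FixesPart v ⊎ length (fixed v) ≡ p
  fixed-count v = count p∣moved (trans (sym (part-length _)) (length-filter-¬ (fixed? v) (nearPart v)))
    where
    open Generator (isGen v)
    moved = filter (¬? ∘ fixed? v) (nearPart v)

    near-closed : ∀ {u} → u ∈ nearPart v → act (gen v) u ∈ nearPart v
    near-closed u∈ = ∈-part⁺ (trans (side-act (gen v) (∈-part⁻ u∈)) (cong side fixes))

    moved-closed : ∀ {u} → u ∈ moved → act (gen v) u ∈ moved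
    moved-closed u∈ with ∈-filter⁻ (¬? ∘ fixed? v) {xs = nearPart v} u∈
    ... | near , moves = ∈-filter⁺ (¬? ∘ fixed? v) (near-closed near) (moves ∘ act-injective (gen v))

    p∣moved : p ∣ length moved
    p∣moved = Cyclic.order-divides (gen v) p order _≟_ moved (filter⁺ (¬? ∘ fixed? v) (part-unique _))
      (λ {u} u∈ i 0<i i<p eq → proj₂ (∈-filter⁻ (¬? ∘ fixed? v) {xs = nearPart v} u∈)
        (fix-coprime (gen v) (<prime⇒coprime p-prime 0<i i<p) 0<i eq (trans (act-cong order u) (act-ε u))))
      moved-closed

    none-moved : length moved ≡ 0 → FixesPart v
    none-moved eq u same = decidable-stable (fixed? v u) λ moves →
      empty eq (∈-filter⁺ (¬? ∘ fixed? v) (∈-part⁺ same) moves)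
      where
      empty : ∀ {zs : List V} → length zs ≡ 0 → ∀ {z} → z ∉ zs
      empty {[]} _ ()

    v∈fixed : v ∈ fixed v
    v∈fixed = ∈-filter⁺ (fixed? v) (∈-part⁺ refl) fixes

    count : p ∣ length moved → 2 * p ≡ length (fixed v) + length moved → FixesPart v ⊎ length (fixed v) ≡ p
    count (divides zero eq) _ = inj₁ (none-moved eq)
    count (divides (suc zero) eq) total = inj₂ (ℕₚ.+-cancelʳ-≡ (1 * p) _ _
      (trans (cong (length (fixed v) +_) (sym eq)) (sym total)))
    count (divides (suc (suc k)) eq) total = ⊥-elim (ℕₚ.<-irrefl total (ℕₚ.≤-trans
      (ℕₚ.+-monoˡ-≤ (2 * p) (0<length v∈fixed)) (ℕₚ.+-monoʳ-≤ (length (fixed v))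
        (subst (2 * p ≤_) (sym eq) (ℕₚ.*-monoˡ-≤ p {2} {suc (suc k)} (s≤s (s≤s z≤n)))))))

  private
    -- Some element carries `v` to `u`, whichever side `u` is on, and conjugation takes generators
    -- to generators; so one vertex decides which construction of blocks applies to all.
    fixesPart-everywhere : ∀ {v} → FixesPart v → ∀ u → FixesPart u
    fixesPart-everywhere {v} fp u w same with transitive (opp-side v) (opp-side u)
    ... | g , refl , _ = subst (λ z → act (gen (act g v)) z ≡ z) (act-⁻¹ʳ g w)
          (fixed-act g (fp (act (g ⁻¹) w) (subst (λ z → side _ ≡ side z) (act-⁻¹ˡ g v) (side-act (g ⁻¹) same))))

    fixedBlocks : (∀ v → length (fixed v) ≡ p) → BlockSystem B p
    fixedBlocks fixed-length = record
      { block        = fixed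
      ; block-length = fixed-length
      ; block-unique = λ v → filter⁺ (fixed? v) (part-unique _)
      ; block-refl   = λ v → intro v (Generator.fixes (isGen v))
      ; block-sym    = λ {u} {v} u∈ → intro u (fixed-sym (elim v u∈))
      ; block-trans  = λ {u} {v} v∈ w∈ → intro u (fixed-trans (elim u v∈) (elim v w∈))
      ; block-act    = λ g {u} {v} u∈ → intro (act g v) (fixed-act g (elim v u∈))
      ; block-side   = λ {u} {v} u∈ → fixed-side (elim v u∈)
      }
      where
      intro : ∀ v {u} → act (gen v) u ≡ u → u ∈ fixed v
      intro v eq = ∈-filter⁺ (fixed? v) (∈-part⁺ (fixed-side eq)) eq
      elim : ∀ v {u} → u ∈ fixed v → act (gen v) u ≡ u
      elim v u∈ = proj₂ (∈-filter⁻ (fixed? v) {xs = nearPart v} u∈)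

    -- When a generator fixes its whole side, fixed points give blocks of size 2p, which are too
    -- large. On the other side it is free, with orbits of size p; `farGen v` depends only on the
    -- side of `v`, so these orbits form one partition of that side.
    orbitBlocks : (∀ v → FixesPart v) → BlockSystem B p
    orbitBlocks fp = record
      { block        = block
      ; block-length = λ v → orbit-length (farGen v) p v
      ; block-unique = λ v → orbit-unique (farGen v) p (generator-free (isGen (opp v)) (opp-side v ∘ sym))
      ; block-refl   = λ v → Cyc.orbit-refl v v
      ; block-sym    = λ {u} {v} u∈ → subst (λ a → v ∈ orbit a p u) (sym (farGen-cong (block-side u∈))) (Cyc.orbit-sym v u∈)
      ; block-trans  = λ {u} {v} v∈ w∈ → Cyc.orbit-trans u v∈ (subst (λ a → _ ∈ orbit a p v) (farGen-cong (block-side v∈)) w∈)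
      ; block-act    = block-act
      ; block-side   = block-side
      }
      where
      farGen : V → X
      farGen v = gen (opp v)
      farGen-cong : ∀ {u v} → side u ≡ side v → farGen u ≡ farGen v
      farGen-cong eq = cong (gen ∘ base ∘ not) eq
      block : V → List V
      block v = orbit (farGen v) p v
      module Cyc (v : V) = Cyclic (farGen v) p (Generator.order (isGen (opp v)))
      block-side : ∀ {u v} → u ∈ block v → side u ≡ side v
      block-side {u} {v} u∈ with ∈-applyUpTo⁻ (λ i → act (i ⋆ farGen v) v) u∈
      ... | i , _ , refl = opposite (subst (λ z → side (act (i ⋆ farGen v) v) ≢ side z)
              (fix-⋆ i (farGen v) (Generator.fixes (isGen (opp v)))) (act-opposite (i ⋆ farGen v) (opp-side v))) (opp-side v)
      block-act : ∀ g {u v} → u ∈ block v → act g u ∈ block (act g v)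
      block-act g {u} {v} u∈ with ∈-applyUpTo⁻ (λ i → act (i ⋆ farGen v) v) u∈
      ... | i , _ , refl = subst (_∈ block (act g v)) eq (Cyc.⋆∈orbit (act g v) (i * proj₁ pow) (act g v))
        where
        b = farGen (act g v)
        -- `b` fixes its whole side and in particular `act g (opp v)`, so it and the conjugate of
        -- `farGen v` can be compared as generators at one vertex.
        b-gen : Generator (act g (opp v)) b
        b-gen = move-generator (isGen (opp (act g v)))
          (fp (opp (act g v)) _ (opposite (act-opposite g (opp-side v) ∘ sym) (opp-side (act g v) ∘ sym)))
        conj-gen : Generator (act g (opp v)) (conj g (farGen v))
        conj-gen = conj-generator g (isGen (opp v))
        pow : ∃ λ k → conj g (farGen v) ≈ k ⋆ b
        pow = generates b-gen (Generator.fixes conj-gen) (Generator.order conj-gen)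
        eq : act ((i * proj₁ pow) ⋆ b) (act g v) ≡ act g (act (i ⋆ farGen v) v)
        eq = trans (act-cong (≈-trans (≈-sym (⋆-assoc b i (proj₁ pow))) (≈-trans (⋆-congʳ i (≈-sym (proj₂ pow)))
               (conj-⋆ i g (farGen v)))) (act g v)) (act-conj g (i ⋆ farGen v) v)

  blockSystem : BlockSystem B p
  blockSystem with fixed-count (base false)
  ... | inj₁ fp  = orbitBlocks (fixesPart-everywhere fp)
  ... | inj₂ len = fixedBlocks λ v → [ (λ fp → ⊥-elim (¬fp (fixesPart-everywhere fp (base false)))) , (λ l → l) ]′ (fixed-count v)
    where
    ¬fp : ¬ FixesPart (base false)
    ¬fp fp = ℕₚ.<-irrefl (trans (sym len) (trans (cong length (filter-all (fixed? (base false))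
      (All.tabulate (λ u∈ → fp _ (∈-part⁻ u∈))))) (part-length _))) (ℕₚ.m<m+n p (s≤s z≤n))

-- The graph C(p,4,1), cycles, and the theorem

enumerate : ∀ {A : Set a} {n} (xs : List A) → Unique xs → length xs ≡ n →
            ∃ λ (f : Fin n → A) → (∀ {i j} → f i ≡ f j → i ≡ j) × (∀ i → f i ∈ xs)
enumerate xs uniq refl = List.lookup xs , injective uniq , ∈-lookup
  where
  injective : ∀ {xs} → Unique xs → ∀ {i j} → List.lookup xs i ≡ List.lookup xs j → i ≡ j
  injective {x ∷ xs} uniq       {zero}  {zero}  eq = refl
  injective {x ∷ xs} uniq       {zero}  {suc j} eq =
    contradiction (subst (_∈ xs) (sym eq) (∈-lookup j)) (Unique[x∷xs]⇒x∉xs uniq)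
  injective {x ∷ xs} uniq       {suc i} {zero}  eq =
    contradiction (subst (_∈ xs) eq (∈-lookup i)) (Unique[x∷xs]⇒x∉xs uniq)
  injective {x ∷ xs} (_ ∷ uniq) {suc i} {suc j} eq = cong suc (injective uniq eq)

parity : Fin 4 → Bool
parity 0F = false
parity 1F = true
parity 2F = false
parity 3F = true

parity-sucₘ : ∀ i → parity (sucₘ i) ≡ not (parity i)
parity-sucₘ 0F = refl
parity-sucₘ 1F = refl
parity-sucₘ 2F = refl
parity-sucₘ 3F = refl

module PX₄₁ {q : ℕ} {G : Group c ℓ} (A : AutAction G (PX (suc (suc q)) 4 1)) (regular : AutAction.ArcRegular A) where
  open Group G using (_≈_; ε) renaming (Carrier to X)
  open AutAction A
  open AutActionProperties A
  open Modular 3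
  open PX₁Adjacency (suc (suc q)) 3

  private
    p : ℕ
    p = suc (suc q)

    Γ : Multigraph
    Γ = PX p 4 1

    3≤4 : 3 ≤ 4
    3≤4 = s≤s (s≤s (s≤s z≤n))

    side : V Γ → Bool
    side v = parity (proj₁ v)

    opposite⇒next : ∀ i j → parity i ≢ parity j → Next i j
    opposite⇒next 0F 0F ≢ = contradiction refl ≢
    opposite⇒next 0F 1F ≢ = inj₁ refl
    opposite⇒next 0F 2F ≢ = contradiction refl ≢
    opposite⇒next 0F 3F ≢ = inj₂ refl
    opposite⇒next 1F 0F ≢ = inj₂ refl
    opposite⇒next 1F 1F ≢ = contradiction refl ≢
    opposite⇒next 1F 2F ≢ = inj₁ refl
    opposite⇒next 1F 3F ≢ = contradiction refl ≢
    opposite⇒next 2F 0F ≢ = contradiction refl ≢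
    opposite⇒next 2F 1F ≢ = inj₂ refl
    opposite⇒next 2F 2F ≢ = contradiction refl ≢
    opposite⇒next 2F 3F ≢ = inj₁ refl
    opposite⇒next 3F 0F ≢ = inj₁ refl
    opposite⇒next 3F 1F ≢ = contradiction refl ≢
    opposite⇒next 3F 2F ≢ = inj₂ refl
    opposite⇒next 3F 3F ≢ = contradiction refl ≢

    opposite⇒adj : ∀ {u w} → side u ≢ side w → Adj Γ u w
    opposite⇒adj {u} {w} uw = next⇒adj (opposite⇒next (proj₁ u) (proj₁ w) uw)

    adj⇒opposite : ∀ {u w} → Adj Γ u w → side u ≡ not (side w)
    adj⇒opposite {u} {w} adj with adj⇒next adj
    ... | inj₁ refl = trans (sym (not-involutive _)) (cong not (sym (parity-sucₘ _)))
    ... | inj₂ refl = parity-sucₘ _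

    ends-injective : ∀ {e e′ : E Γ} → end₁ Γ e ≡ end₁ Γ e′ → end₂ Γ e ≡ end₂ Γ e′ → e ≡ e′
    ends-injective {i , a ∷ b ∷ []} {_ , _ ∷ _ ∷ []} refl refl = refl

    ends-unique : ∀ {e e′ u w} → Ends Γ e u w → Ends Γ e′ u w → e ≡ e′
    ends-unique (inj₁ (refl , refl)) (inj₁ (e₁ , e₂)) = ends-injective (sym e₁) (sym e₂)
    ends-unique (inj₂ (refl , refl)) (inj₂ (e₁ , e₂)) = ends-injective (sym e₁) (sym e₂)
    ends-unique (inj₁ (refl , refl)) (inj₂ (e₁ , e₂)) =
      contradiction (trans (cong sucₘ (sym (cong proj₁ e₁))) (cong proj₁ e₂)) (sucₘsucₘ≢ 3≤4)
    ends-unique (inj₂ (refl , refl)) (inj₁ (e₁ , e₂)) =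
      contradiction (trans (cong sucₘ (sym (cong proj₁ e₁))) (cong proj₁ e₂)) (sucₘsucₘ≢ 3≤4)

    other-end : ∀ {e u w u′ w′} → Ends Γ e u w → Ends Γ e u′ w′ → u ≡ u′ → w ≡ w′
    other-end (inj₁ (refl , refl)) (inj₁ (refl , refl)) _    = refl
    other-end (inj₁ (refl , refl)) (inj₂ (refl , refl)) eq   = sym eq
    other-end (inj₂ (refl , refl)) (inj₁ (refl , refl)) eq   = sym eq
    other-end (inj₂ (refl , refl)) (inj₂ (refl , refl)) _    = refl

    arc : ∀ {u w} → Adj Γ u w → Arc Γ
    arc {u} (e , inj₁ (e₁ , _)) = u , e , inj₁ (sym e₁)
    arc {u} (e , inj₂ (_ , e₂)) = u , e , inj₂ (sym e₂)

    arc-edge : ∀ {u w} (adj : Adj Γ u w) → proj₁ (proj₂ (arc adj)) ≡ proj₁ adj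
    arc-edge (e , inj₁ _) = refl
    arc-edge (e , inj₂ _) = refl

    arc-vertex : ∀ {u w} (adj : Adj Γ u w) → proj₁ (arc adj) ≡ u
    arc-vertex (e , inj₁ _) = refl
    arc-vertex (e , inj₂ _) = refl

    indices : Bool → List (Fin 4)
    indices false = 0F ∷ 2F ∷ []
    indices true  = 1F ∷ 3F ∷ []

    ∈-indices⁺ : ∀ i → i ∈ indices (parity i)
    ∈-indices⁺ 0F = here refl
    ∈-indices⁺ 1F = here refl
    ∈-indices⁺ 2F = there (here refl)
    ∈-indices⁺ 3F = there (here refl)

    ∈-indices⁻ : ∀ b {i} → i ∈ indices b → parity i ≡ b
    ∈-indices⁻ false (here refl)         = refl
    ∈-indices⁻ false (there (here refl)) = refl
    ∈-indices⁻ true  (here refl)         = refl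
    ∈-indices⁻ true  (there (here refl)) = refl

    indices-unique : ∀ b → Unique (indices b)
    indices-unique false = ((λ ()) ∷ []) ∷ [] ∷ []
    indices-unique true  = ((λ ()) ∷ []) ∷ [] ∷ []

    indices-length : ∀ b → length (indices b) ≡ 2
    indices-length false = refl
    indices-length true  = refl

  bipartite : CompleteBipartiteAction G (V Γ) (2 * p)
  bipartite = record
    { action      = vertexAction
    ; _≟_         = Productₚ.≡-dec Finₚ._≟_ (Vecₚ.≡-dec Finₚ._≟_)
    ; side        = side
    ; base        = λ { false → 0F , zero ∷ [] ; true → 1F , zero ∷ [] }
    ; side-base   = λ { false → refl ; true → refl }
    ; part        = part
    ; part-unique = λ b → cartesianProductWith⁺ _,_ Productₚ.,-injective (indices-unique b) (allVec-unique p 1)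
    ; part-length = λ b → trans (length-cartesianProductWith _,_ (indices b) (allVec p 1))
                      (cong₂ _*_ (indices-length b) (trans (length-allVec p 1) (ℕₚ.*-identityʳ p)))
    ; ∈-part⁺     = λ { {i , x} refl → ∈-cartesianProductWith⁺ _,_ (∈-indices⁺ i) (∈-allVec x) }
    ; ∈-part⁻     = λ {_} {b} → ∈-part⁻ b
    ; side-act    = λ g {u} {v} eq →
        -- Vertices of one side share the neighbour `1+ u`; its image then lies opposite to both of
        -- their images.
        let uw = opposite⇒adj {u} {1+ u} (side≢ u)
            vw = opposite⇒adj {v} {1+ u} (λ eq′ → side≢ u (trans eq eq′))
        in trans (adj⇒opposite (adj-act g uw)) (sym (adj⇒opposite (adj-act g vw)))
    ; transitive  = λ {u} {w} uw u′w′ →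
        let e = opposite⇒adj uw
            e′ = opposite⇒adj u′w′
            g , eqV , eqE = proj₁ regular (arc e) (arc e′)
            gu = trans (cong (actV g) (sym (arc-vertex e))) (trans eqV (arc-vertex e′))
            ge = trans (cong (actE g) (sym (arc-edge e))) (trans eqE (arc-edge e′))
        in g , gu , other-end {proj₁ e′} (subst (λ y → Ends Γ y (actV g u) (actV g w)) ge (ends-act g {proj₁ e} (proj₂ e))) (proj₂ e′) gu
    ; free        = λ g {u} {w} uw gu gw →
        let e = opposite⇒adj uw
            ge = ends-unique {actE g (proj₁ e)} {proj₁ e} (≡.subst₂ (Ends Γ (actE g (proj₁ e))) gu gw (ends-act g {proj₁ e} (proj₂ e))) (proj₂ e)
        in proj₂ regular g (arc e)
             ( trans (cong (actV g) (arc-vertex e)) (trans gu (sym (arc-vertex e)))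
             , trans (cong (actE g) (arc-edge e)) (trans ge (sym (arc-edge e))))
    }
    where
    part : Bool → List (V Γ)
    part b = cartesianProductWith _,_ (indices b) (allVec p 1)
    ∈-part⁻ : ∀ b {v} → v ∈ part b → side v ≡ b
    ∈-part⁻ b v∈ with ∈-cartesianProductWith⁻ _,_ (indices b) (allVec p 1) v∈
    ... | i , x , i∈ , _ , refl = ∈-indices⁻ b i∈
    1+ : V Γ → V Γ
    1+ (i , x) = sucₘ i , x
    side≢ : ∀ u → side u ≢ side (1+ u)
    side≢ (i , x) eq = not-¬ refl (trans eq (parity-sucₘ i))

  module Relabelling (blocks : BlockSystem bipartite (suc (suc q))) where
    open BlockSystem blocks
    open CompleteBipartiteAction bipartite using (_≟_; base; side-base; part; part-unique; part-length; ∈-part⁻)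

    private
      second : ∀ b → ∃ λ v → side v ≡ b × v ∉ block (base b)
      second b with Finite.∃-outside _≟_ {block (base b)} {part b} (part-unique b)
        (≡.subst₂ _<_ (sym (block-length (base b))) (sym (part-length b)) (ℕₚ.m<m+n p (s≤s z≤n)))
      ... | v , v∈ , v∉ = v , ∈-part⁻ v∈ , v∉

      -- Each side has 2p vertices, hence two blocks. They are numbered alternately between the
      -- sides, so that block numbers have the parity of the fibres they replace.
      representative : Fin 4 → V Γ
      representative 0F = base false
      representative 1F = base true
      representative 2F = proj₁ (second false)
      representative 3F = proj₁ (second true)

      representative-side : ∀ i → side (representative i) ≡ parity i
      representative-side 0F = refl
      representative-side 1F = refl
      representative-side 2F = proj₁ (proj₂ (second false))
      representative-side 3F = proj₁ (proj₂ (second true))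

      representative-injective : ∀ i j → representative j ∈ block (representative i) → i ≡ j
      representative-injective i j j∈ = distinct i j j∈ (trans (sym (representative-side i))
          (trans (sym (block-side j∈)) (representative-side j)))
        where
        distinct : ∀ i j → representative j ∈ block (representative i) → parity i ≡ parity j → i ≡ j
        distinct 0F 0F _  _ = refl
        distinct 1F 1F _  _ = refl
        distinct 2F 2F _  _ = refl
        distinct 3F 3F _  _ = refl
        distinct 0F 3F _  ()
        distinct 2F 3F _  ()
        distinct 0F 2F j∈ _ = contradiction j∈ (proj₂ (proj₂ (second false)))
        distinct 2F 0F j∈ _ = contradiction (block-sym j∈) (proj₂ (proj₂ (second false)))
        distinct 1F 3F j∈ _ = contradiction j∈ (proj₂ (proj₂ (second true)))
        distinct 3F 1F j∈ _ = contradiction (block-sym j∈) (proj₂ (proj₂ (second true)))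

      points : ∀ i → ∃ λ (f : Fin p → V Γ) → (∀ {a b} → f a ≡ f b → a ≡ b) × (∀ a → f a ∈ block (representative i))
      points i = enumerate (block (representative i)) (block-unique _) (block-length _)

      φ : V Γ → V Γ
      φ (i , a ∷ []) = proj₁ (points i) a

      φ-block : ∀ v → φ v ∈ block (representative (proj₁ v))
      φ-block (i , a ∷ []) = proj₂ (proj₂ (points i)) a

      φ-side : ∀ v → side (φ v) ≡ side v
      φ-side v = trans (block-side (φ-block v)) (representative-side (proj₁ v))

      same-block⇒index : ∀ v w → φ w ∈ block (φ v) → proj₁ v ≡ proj₁ w
      same-block⇒index v w w∈ = representative-injective _ _
        (block-trans (block-trans (φ-block v) w∈) (block-sym (φ-block w)))

      index⇒same-block : ∀ v w → proj₁ v ≡ proj₁ w → φ w ∈ block (φ v)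
      index⇒same-block v w eq = block-trans (block-sym (φ-block v))
        (subst (λ i → φ w ∈ block (representative i)) (sym eq) (φ-block w))

      φ-injective : ∀ {v w} → φ v ≡ φ w → v ≡ w
      φ-injective {v@(i , a ∷ [])} {w@(j , b ∷ [])} eq
        with refl ← same-block⇒index v w (subst (_∈ block (φ v)) eq (block-refl (φ v)))
        = cong (λ a → i , a ∷ []) (proj₁ (proj₂ (points i)) eq)

      φ⁻¹ : ∀ v → ∃ λ w → φ w ≡ v
      φ⁻¹ = Finite.injective⇒surjective _≟_
        (cartesianProductWith⁺ _,_ Productₚ.,-injective (allFin⁺ 4) (allVec-unique p 1))
        (λ (i , x) → ∈-cartesianProductWith⁺ _,_ (∈-allFin i) (∈-allVec x)) φ-injective

      -- In a complete bipartite graph every bijection respecting the sides preserves adjacency.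
      -- This is why the blocks can be renamed as fibres.
      joined : ∀ x → Adj Γ (φ (end₁ Γ x)) (φ (end₂ Γ x))
      joined x@(i , _) = opposite⇒adj λ eq → not-¬ refl (trans (sym (φ-side (end₁ Γ x)))
        (trans eq (trans (φ-side (end₂ Γ x)) (parity-sucₘ i))))

      ψ : E Γ → E Γ
      ψ x = proj₁ (joined x)

      φ-ends : ∀ x {u w} → Ends Γ (ψ x) (φ u) (φ w) → Ends Γ x u w
      φ-ends x ends with joined x
      φ-ends x (inj₁ (f₁ , f₂)) | e , inj₁ (e₁ , e₂) = inj₁ (φ-injective (trans (sym e₁) f₁) , φ-injective (trans (sym e₂) f₂))
      φ-ends x (inj₂ (f₁ , f₂)) | e , inj₁ (e₁ , e₂) = inj₂ (φ-injective (trans (sym e₁) f₁) , φ-injective (trans (sym e₂) f₂))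
      φ-ends x (inj₁ (f₁ , f₂)) | e , inj₂ (e₁ , e₂) = inj₂ (φ-injective (trans (sym e₂) f₂) , φ-injective (trans (sym e₁) f₁))
      φ-ends x (inj₂ (f₁ , f₂)) | e , inj₂ (e₁ , e₂) = inj₁ (φ-injective (trans (sym e₂) f₂) , φ-injective (trans (sym e₁) f₁))

      ψ-injective : ∀ {x y} → ψ x ≡ ψ y → x ≡ y
      ψ-injective {x} {y} eq = ends-unique (inj₁ (refl , refl))
        (φ-ends y (subst (λ e → Ends Γ e _ _) eq (proj₂ (joined x))))

      ψ⁻¹ : ∀ e → ∃ λ x → ψ x ≡ e
      ψ⁻¹ = Finite.injective⇒surjective (Productₚ.≡-dec Finₚ._≟_ (Vecₚ.≡-dec Finₚ._≟_))
        (cartesianProductWith⁺ _,_ Productₚ.,-injective (allFin⁺ 4) (allVec-unique p 2))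
        (λ (i , x) → ∈-cartesianProductWith⁺ _,_ (∈-allFin i) (∈-allVec x)) ψ-injective

    private
      toV : V Γ → V Γ
      toV v = proj₁ (φ⁻¹ v)

      φ-toV : ∀ v → φ (toV v) ≡ v
      φ-toV v = proj₂ (φ⁻¹ v)

      toE : E Γ → E Γ
      toE e = proj₁ (ψ⁻¹ e)

      ψ-toE : ∀ e → ψ (toE e) ≡ e
      ψ-toE e = proj₂ (ψ⁻¹ e)

    relabelling : Γ ≅ Γ
    relabelling = record
      { toV = toV
      ; fromV = φ
      ; toV-fromV = λ v → φ-injective (φ-toV (φ v))
      ; fromV-toV = φ-toV
      ; toE = toE
      ; fromE = ψ
      ; toE-fromE = λ e → ψ-injective (ψ-toE (ψ e))
      ; fromE-toE = ψ-toE
      ; to-incidence = λ e → φ-ends (toE e) {toV (end₁ Γ e)} {toV (end₂ Γ e)}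
          (≡.subst₂ (Ends Γ (ψ (toE e))) (sym (φ-toV (end₁ Γ e))) (sym (φ-toV (end₂ Γ e)))
            (subst (λ y → Ends Γ y (end₁ Γ e) (end₂ Γ e)) (sym (ψ-toE e)) (inj₁ (refl , refl))))
      }

    relabelled-fibrePreserving : PXGraph.FibrePreserving q 3 1 3≤4 (Transport.transport relabelling A)
    relabelled-fibrePreserving g {u} {v} eq = same-block⇒index (toV (actV g (φ u))) (toV (actV g (φ v)))
      (≡.subst₂ (λ x y → y ∈ block x) (sym (φ-toV (actV g (φ u)))) (sym (φ-toV (actV g (φ v))))
        (block-act g (index⇒same-block u v eq)))

-- At s = 0 the formula for `PX` has a single vertex over each index and p edges to the next, so the
-- general argument covers the fat cycle.
fatCycle≅PX : ∀ p r → FatCycle p r ≅ PX p r 0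
fatCycle≅PX p r = record
  { toV = _, []
  ; fromV = proj₁
  ; toV-fromV = λ { (i , []) → refl }
  ; fromV-toV = λ _ → refl
  ; toE = λ (i , a) → i , a ∷ []
  ; fromE = λ { (i , a ∷ []) → i , a }
  ; toE-fromE = λ { (i , a ∷ []) → refl }
  ; fromE-toE = λ _ → refl
  ; to-incidence = λ _ → inj₁ (refl , refl)
  }

module CycleGraph (q m : ℕ) (3≤r : 3 ≤ suc m) {G : Group c ℓ} (A : AutAction G (Cycle (suc (suc q) * suc m)))
                  (regular : AutAction.ArcRegular A) where
  open AutAction A
  open AutActionProperties A
  open Modular m

  private
    p r n : ℕ
    p = suc (suc q)
    r = suc m
    n = p * r

    -- The argument is the predecessor of `p * r` in the form to which `p * r` computes.
    module N = Modular (m + suc q * suc m)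

    Γ : Multigraph
    Γ = Cycle n

    3≤n : 3 ≤ n
    3≤n = ℕₚ.≤-trans 3≤r (ℕₚ.m≤m+n r (suc q * r))

    index : Fin n → Fin r
    index e = proj₂ (remQuot {p} r e)

    index-mod : ∀ e → index e ≡ [ toℕ e ]
    index-mod e = trans (sym ([toℕ] (index e))) ([]-cong (toℕ (index e)) (toℕ e)
      (sym (trans (cong (_% r) (trans (cong toℕ (sym (combine-remQuot {p} r e))) (toℕ-combine (proj₁ (remQuot {p} r e)) (index e))))
        (%-remove-+ˡ (toℕ (index e)) (m∣m*n (toℕ (proj₁ (remQuot {p} r e))))))))

    index-sucₘ : ∀ e → index (sucₘ e) ≡ sucₘ (index e)
    index-sucₘ e = trans (index-mod (sucₘ e)) (trans ([]-cong (toℕ (sucₘ e)) (suc (toℕ e))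
      (trans (cong (_% r) (toℕ-mod (suc (toℕ e)) n)) (m∣n⇒o%n%m≡o%m r n (suc (toℕ e)) (n∣m*n p))))
      (trans (sym (sucₘ-[] (toℕ e))) (cong sucₘ (sym (index-mod e)))))

    index-zero : index zero ≡ zero
    index-zero = index-mod zero

    connects : Connects
    connects P forward backward {e} pe e′ = let k , eq = N.sucₘ^-reaches e e′ in subst P eq (walk k)
      where
      walk : ∀ k → P (N.sucₘ^ k e)
      walk zero    = pe
      walk (suc k) = forward refl (walk k)

    fork⇒≡ : ∀ {u u′} → Fork Γ u u′ → u ≡ u′
    fork⇒≡ (y , y′ , inj₁ (eq , refl , refl)) = N.sucₘ-injective eq
    fork⇒≡ (y , y′ , inj₂ (eq , refl , refl)) = cong sucₘ eq

    -- A fork in a simple cycle has equal ends, whereas a path of length two in a cycle of length at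
    -- least 3 has distinct ones.
    unfolded : Unfolded
    unfolded g {e} refl fork = N.sucₘsucₘ≢ 3≤n (sym (ActionProperties.act-injective vertexAction g (fork⇒≡ fork)))

  open Orientation regular (λ e eq → N.sucₘ≢ 3≤n (sym eq)) unfolded connects zero

  private
    offset : Group.Carrier G → Fin r
    offset g = index (actE g zero)

    index-forward : ∀ g → reverses g ≡ false → ∀ e → index (actE g e) ≡ offset g +ₘ index e
    index-forward g dir = connects (λ e → index (actE g e) ≡ o +ₘ index e)
      (λ { {e} refl h → trans (cong index (equivariant e)) (trans (index-sucₘ _) (trans (cong sucₘ h)
             (trans (sucₘ-+ʳ o (index e)) (cong (o +ₘ_) (sym (index-sucₘ e)))))) })
      (λ { {e} refl h → sucₘ-injective (trans (sym (index-sucₘ _)) (trans (cong index (sym (equivariant e)))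
             (trans h (trans (cong (o +ₘ_) (index-sucₘ e)) (sym (sucₘ-+ʳ o (index e))))))) })
      (sym (trans (cong (o +ₘ_) index-zero) (+ₘ-identityʳ o)))
      where
      o = offset g
      equivariant : ∀ e → actE g (sucₘ e) ≡ sucₘ (actE g e)
      equivariant e = trans (proj₁ (forward g dir (sucₘ e))) (sym (proj₂ (forward g dir e)))

    index-backward : ∀ g → reverses g ≡ true → ∀ e → index (actE g e) ≡ offset g +ₘ (-ₘ index e)
    index-backward g dir = connects (λ e → index (actE g e) ≡ o +ₘ (-ₘ index e))
      (λ { {e} refl h → sucₘ-injective (trans (sym (index-sucₘ _)) (trans (cong index (equivariant e)) (trans h
             (trans (sym (sucₘ-neg o (index e))) (cong (λ i → sucₘ (o +ₘ (-ₘ i))) (sym (index-sucₘ e))))))) })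
      (λ { {e} refl h → trans (cong index (sym (equivariant e))) (trans (index-sucₘ _) (trans (cong sucₘ h)
             (trans (cong (λ i → sucₘ (o +ₘ (-ₘ i))) (index-sucₘ e)) (sucₘ-neg o (index e))))) })
      (sym (trans (cong (λ i → o +ₘ (-ₘ i)) index-zero) (trans (cong (o +ₘ_) -ₘ-zero) (+ₘ-identityʳ o))))
      where
      o = offset g
      equivariant : ∀ e → sucₘ (actE g (sucₘ e)) ≡ actE g e
      equivariant e = trans (proj₂ (backward g dir (sucₘ e))) (sym (proj₁ (backward g dir e)))

    -- Division with remainder by r: the remainder is the index, the quotient numbers the p parallel
    -- edges.
    toEdge : Fin n → Edge p r 0
    toEdge e = index e , proj₁ (remQuot {p} r e) ∷ []

    fromEdge : Edge p r 0 → Fin n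
    fromEdge (i , a ∷ []) = combine a i

    to-from : ∀ x → toEdge (fromEdge x) ≡ x
    to-from (i , a ∷ []) = cong (λ (a , i) → i , a ∷ []) (remQuot-combine a i)

    from-to : ∀ e → fromEdge (toEdge e) ≡ e
    from-to e = combine-remQuot {p} r e

    index-from : ∀ x → index (fromEdge x) ≡ proj₁ x
    index-from x = cong proj₁ (to-from x)

    []-unique : (u w : Vec (Fin p) 0) → u ≡ w
    []-unique [] [] = refl

  semidirect : Prime p → ¬ (2 ∣ p) → ¬ (p ∣ r) → Σ (DihAction p 1 r) (λ θ → IsoToSD G θ)
  semidirect = DirectedActionProperties.semidirect 3≤r record
    { action     = record
      { act      = λ g x → toEdge (actE g (fromEdge x))
      ; act-cong = λ g≈h x → cong toEdge (actE-cong g≈h (fromEdge x))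
      ; act-ε    = λ x → trans (cong toEdge (actE-ε (fromEdge x))) (to-from x)
      ; act-∙    = λ g h x → cong toEdge (trans (actE-∙ g h (fromEdge x)) (cong (actE g) (sym (from-to _))))
      }
    ; reverses   = reverses
    ; preserve   = λ g dir {x} {y} (eq , _) → trans (cong sucₘ (index-forward g dir (fromEdge x)))
        (trans (sucₘ-+ʳ (offset g) (index (fromEdge x))) (trans (cong (offset g +ₘ_) (trans (cong sucₘ (index-from x)) (trans eq (sym (index-from y)))))
          (sym (index-forward g dir (fromEdge y))))) , []-unique _ _
    ; reverse    = λ g dir {x} {y} (eq , _) → trans (cong sucₘ (index-backward g dir (fromEdge y)))
        (trans (cong (λ i → sucₘ (offset g +ₘ (-ₘ i))) (trans (index-from y) (trans (sym eq) (cong sucₘ (sym (index-from x))))))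
          (trans (sucₘ-neg (offset g) (index (fromEdge x))) (sym (index-backward g dir (fromEdge x))))) , []-unique _ _
    ; transitive = λ b x y → let g , dir , eq = oriented-transitive b (fromEdge x) (fromEdge y)
                             in g , dir , trans (cong toEdge eq) (to-from y)
    ; free       = λ g x dir eq → oriented-free g (fromEdge x) dir (trans (sym (from-to _)) (cong fromEdge eq))
    }

theorem4p2 : ∀ {c ℓ} (p s : ℕ) (δ : Sign) (r : ℕ) →
    Prime p → ¬ (2 ∣ p) → 3 ⊔ suc s ≤ r → ¬ (p ∣ r) →
    (G : Group c ℓ) (A : AutAction G (CStar p r s δ)) → AutAction.ArcRegular A →
    Σ (DihAction p (suc s) r) (λ θ → IsoToSD G θ)
theorem4p2 zero _ _ _ p-prime = contradiction p-prime ¬prime[0]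
theorem4p2 (suc zero) _ _ _ p-prime = contradiction p-prime ¬prime[1]
theorem4p2 (suc (suc q)) zero Sign.+ (suc m) p-prime 2∤p r≥ p∤r G A regular =
  PXGraph.unfolded⇒semidirect q m 0 3≤r T.transport (T.transport-regular regular)
    (PXGraph.fibrePreserving⇒unfolded q m 0 3≤r T.transport (PX₀-fibrePreserving q m 3≤r T.transport)) p-prime 2∤p p∤r
  where
  3≤r = ℕₚ.m⊔n≤o⇒m≤o 3 1 r≥
  module T = Transport (fatCycle≅PX (suc (suc q)) (suc m)) A
theorem4p2 (suc (suc q)) zero Sign.- (suc m) p-prime 2∤p r≥ p∤r G A regular =
  CycleGraph.semidirect q m (ℕₚ.m⊔n≤o⇒m≤o 3 1 r≥) A regular p-prime 2∤p p∤r
theorem4p2 (suc (suc q)) (suc zero) δ (suc m) p-prime 2∤p r≥ p∤r G A regular with m ℕₚ.≟ 3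
... | no m≢3 = PXGraph.unfolded⇒semidirect q m 1 3≤r A regular
    (PXGraph.fibrePreserving⇒unfolded q m 1 3≤r A (PX₁-fibrePreserving q m 3≤r (m≢3 ∘ ℕₚ.suc-injective) A)) p-prime 2∤p p∤r
  where
  3≤r = ℕₚ.m⊔n≤o⇒m≤o 3 2 r≥
-- r = 4: the graph is K_{2p,2p}, and the action is first transported so that the blocks become the
-- fibres.
... | yes refl = PXGraph.unfolded⇒semidirect q 3 1 (ℕₚ.m⊔n≤o⇒m≤o 3 2 r≥) T.transport (T.transport-regular regular)
    (PXGraph.fibrePreserving⇒unfolded q 3 1 (ℕₚ.m⊔n≤o⇒m≤o 3 2 r≥) T.transport R.relabelled-fibrePreserving) p-prime 2∤p p∤r
  where
  module R = PX₄₁.Relabelling A regular (BlocksExist.blockSystem p-prime 2∤p (PX₄₁.bipartite A regular))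
  module T = Transport R.relabelling A
theorem4p2 (suc (suc zero)) (suc (suc t)) δ (suc m) p-prime 2∤p = contradiction ∣-refl 2∤p
theorem4p2 (suc (suc (suc q))) (suc (suc t)) δ (suc m) p-prime 2∤p r≥ p∤r G A regular =
  PXGraph.unfolded⇒semidirect (suc q) m (suc (suc t)) 3≤r A regular (PX≥2.PX≥2-unfolded q m t 3≤r A) p-prime 2∤p p∤r
  where
  3≤r = ℕₚ.m⊔n≤o⇒m≤o 3 (3 + t) r≥
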